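{- Let $\lambda$ be a Borel probability measure on $[0,1]$. Let $\mathcal P^1$ and $\mathcal P^2$ be two sequences of partitions that are log-balanced a.e. with respect to $\lambda$, with a.e. weight functions $f_1$ and $f_2$, respectively, such that all the following hold: (i) $\sum_{n=1}^\infty e^{ -\delta f_1(n)}<\infty$ for every $\delta>0$; (ii) $f_2$ is nondecreasing; (iii) $f_2(n+1)-f_2(n)=o(f_2(n))$ as $n\to\infty$. Then $$\lim_{n\to\infty}\frac{f_2(L_n(x,\mathcal P^1,\mathcal P^2))}{f_1(n)}=1\quad\text{for }\lambda\text{ -a.e. }x.$$
   Context: $\mathbb N$ includes $0$. A topological partition of $[0,1]$ is a collection of pairwise disjoint nonempty open intervals the union of whose closures is $[0,1]$. A sequence of partitions $\mathcal P=\{P_n\}_{n\in\mathbb N}$ is a sequence of topological partitions of $[0,1]$; $E=E^{\mathcal P}$ is the set of all endpoints of intervals in all the $P_n$; for $x\in[0,1]\setminus E$, $I_n(x)$ is the unique interval of $P_n$ containing $x$. $\mathcal P$ is log-balanced a.e. with respect to a Borel probability measure $\lambda$ on $[0,1]$ if $\lambda(E)=0$ and there is $f:\mathbb N\to\mathbb R$ with $f(n)\to+\infty$ such that $\lim_{n\to\infty}\frac{ -\log\lambda(I_n(x))}{f(n)}=1$ for $\lambda$-a.e. $x$; any such $f$ is called an a.e. weight function of $\mathcal P$ with respect to $\lambda$. For sequences of partitions $\mathcal P^1,\mathcal P^2$ with endpoint sets $E^1,E^2$ and intervals $I_n^1(x),I_n^2(x)$, the Lochs index is $L_n(x,\mathcal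 P^1,\mathcal P^2)=\sup\{\ell\in\mathbb N : I_n^1(x)\subseteq I_\ell^2(x)\}$ (supremum in $\mathbb N\cup\{\infty\}$) for $x\in[0,1]\setminus(E^1\cup E^2)$. When both sequences are log-balanced with respect to $\lambda$, it is finite for $\lambda$-a.e. $x$, so $f_2(L_n(x,\mathcal P^1,\mathcal P^2))$ is defined for a.e. $x$. -}

module Defs where

open import Level using (0ℓ) renaming (suc to lsuc)
open import Algebra.Bundles using (CommutativeRing; Semiring)
open import Axiom.ExcludedMiddle using (ExcludedMiddle)
open import Data.Fin.Base using (toℕ)
open import Data.Nat.Base as ℕ using (ℕ; suc)
open import Data.Product.Base using (Σ-syntax; ∃-syntax; _×_; _,_; proj₁; proj₂)
open import Data.Sum.Base using (_⊎_; inj₁; inj₂)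
open import Relation.Binary.Bundles using (TotalOrder)
open import Relation.Binary.Core using (Rel)
open import Relation.Binary.PropositionalEquality.Core using (_≡_; _≢_)
open import Relation.Binary.Structures using (IsTotalOrder)
open import Relation.Nullary using (¬_; yes; no)
open import Relation.Nullary.Construct.Add.Supremum using (_⁺; [_])
open import Relation.Unary using (Pred; _∈_; _∉_; _⊆_; _≐_; _⊥_; U; ∅; ∁; ⋃)

import Algebra.Construct.NaturalChoice.Max as Max
import Algebra.Definitions.RawSemiring as RawSemiringDefs
import Relation.Binary.Construct.Add.Supremum.NonStrict ℕ._≤_ as ℕ∞
import Relation.Binary.Construct.NonStrictToStrict as ToStrict

module _ {A : Set} (_≤_ : Rel A 0ℓ) where

  IsUpperBound : Pred A 0ℓ → A → Set
  IsUpperBound S b = ∀ x → x ∈ S → x ≤ b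

  IsSupremum : Pred A 0ℓ → A → Set
  IsSupremum S s = IsUpperBound S s × (∀ b → IsUpperBound S b → s ≤ b)

-- The real numbers, which the library lacks, enter through their
-- axiomatic characterisation as the Dedekind-complete ordered field,
-- over a setoid equality as in the library's algebraic bundles.  The
-- inverse is total; its value at 0 is unspecified.

record CompleteOrderedField : Set (lsuc 0ℓ) where
  infix  8 _⁻¹
  infixl 7 _/_
  infix  4 _≤_

  field
    commutativeRing : CommutativeRing 0ℓ 0ℓ

  open CommutativeRing commutativeRing public

  field
    _≤_          : Rel Carrier 0ℓ
    isTotalOrder : IsTotalOrder _≈_ _≤_
    _⁻¹          : Carrier → Carrier
    0≉1          : ¬ (0# ≈ 1#)
    *-inverseʳ   : ∀ x → ¬ (x ≈ 0#) → x * x ⁻¹ ≈ 1#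
    +-monoˡ-≤    : ∀ z {x y} → x ≤ y → x + z ≤ y + z
    *-nonNeg     : ∀ {x y} → 0# ≤ x → 0# ≤ y → 0# ≤ x * y
    complete     : (S : Pred Carrier 0ℓ) → (∃[ x ] x ∈ S) →
                   (∃[ b ] IsUpperBound _≤_ S b) → ∃[ s ] IsSupremum _≤_ S s

  totalOrder : TotalOrder 0ℓ 0ℓ 0ℓ
  totalOrder = record { isTotalOrder = isTotalOrder }

  open ToStrict _≈_ _≤_ public using (_<_)
  open Max totalOrder public using (_⊔_)
  open RawSemiringDefs (Semiring.rawSemiring semiring) public
    using (_^_; sum) renaming (_×_ to _·_)

  ∣_∣ : Carrier → Carrier
  ∣ x ∣ = x ⊔ (- x)

  _/_ : Carrier → Carrier → Carrier
  x / y = x * y ⁻¹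

-- The mathematics formalised here is classical, so excluded middle is a
-- parameter.

module Analysis (lem : ExcludedMiddle 0ℓ) (ℝ : CompleteOrderedField) where

  open CompleteOrderedField ℝ

  Eventually : Pred ℕ 0ℓ → Set
  Eventually P = ∃[ N ] (∀ n → N ℕ.≤ n → P n)

  infix 4 _⟶_ _⟶+∞

  _⟶_ : (ℕ → Carrier) → Carrier → Set
  a ⟶ l = ∀ ε → 0# < ε → Eventually (λ n → ∣ a n - l ∣ < ε)

  _⟶+∞ : (ℕ → Carrier) → Set
  a ⟶+∞ = ∀ M → Eventually (λ n → M ≤ a n)

  IsLittleO : (ℕ → Carrier) → (ℕ → Carrier) → Set
  IsLittleO a b = ∀ ε → 0# < ε → Eventually (λ n → ∣ a n ∣ ≤ ε * ∣ b n ∣)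

  partialSum : (ℕ → Carrier) → ℕ → Carrier
  partialSum a n = sum {n} (λ i → a (toℕ i))

  Summable : (ℕ → Carrier) → Set
  Summable a = ∃[ s ] partialSum a ⟶ s

  -- The limit if it exists, and 0 otherwise.
  lim : (ℕ → Carrier) → Carrier
  lim a with lem {∃[ l ] a ⟶ l}
  ... | yes (l , _) = l
  ... | no  _       = 0#

  -- eˣ = lim (1 + x / n)ⁿ; the index is shifted to avoid n = 0.
  exp : Carrier → Carrier
  exp x = lim (λ n → (1# + x / (suc n · 1#)) ^ suc n)

  -- The natural logarithm on (0,∞), and 0 elsewhere.
  log : Carrier → Carrier
  log y with lem {∃[ x ] exp x ≈ y}
  ... | yes (x , _) = x
  ... | no  _       = 0#

  𝕀 : Set
  𝕀 = Σ[ x ∈ Carrier ] 0# ≤ x × x ≤ 1#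

  ⟦_⟧ : 𝕀 → Carrier
  ⟦_⟧ = proj₁

  Interval : Carrier → Carrier → Pred 𝕀 0ℓ
  Interval l r x = l < ⟦ x ⟧ × ⟦ x ⟧ < r

  ClosedInterval : Carrier → Carrier → Pred 𝕀 0ℓ
  ClosedInterval l r x = l ≤ ⟦ x ⟧ × ⟦ x ⟧ ≤ r

  -- Open in the topology of [0,1]: a and b range over all of ℝ, so the
  -- basic neighbourhoods are the traces of open intervals of ℝ.
  IsOpen : Pred 𝕀 0ℓ → Set
  IsOpen V = ∀ x → x ∈ V → ∃[ a ] ∃[ b ] x ∈ Interval a b × Interval a b ⊆ V

  -- The σ-algebra generated by the open sets; `resp` makes it invariant
  -- under extensional equality of predicates.
  data Borel : Pred 𝕀 0ℓ → Set (lsuc 0ℓ) where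
    open-set   : ∀ {A} → IsOpen A → Borel A
    complement : ∀ {A} → Borel A → Borel (∁ A)
    union      : ∀ {A : ℕ → Pred 𝕀 0ℓ} → (∀ n → Borel (A n)) → Borel (⋃ ℕ A)
    resp       : ∀ {A B} → A ≐ B → Borel A → Borel B

  record BorelProbabilityMeasure : Set (lsuc 0ℓ) where
    field
      measure          : ∀ {A} → Borel A → Carrier
      -- The measure depends on the set only, neither on the predicate
      -- presenting it nor on the proof that it is Borel.
      measure-cong     : ∀ {A B} (a : Borel A) (b : Borel B) → A ≐ B →
                         measure a ≈ measure b
      measure-nonNeg   : ∀ {A} (a : Borel A) → 0# ≤ measure a
      measure-∅        : (a : Borel ∅) → measure a ≈ 0#
      measure-U        : (a : Borel U) → measure a ≈ 1#
      measure-additive : ∀ {A : ℕ → Pred 𝕀 0ℓ} (a : ∀ n → Borel (A n)) →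
                         (∀ {m n} → m ≢ n → A m ⊥ A n) →
                         partialSum (λ n → measure (a n)) ⟶ measure (union a)

  open BorelProbabilityMeasure public

  AlmostEverywhere : BorelProbabilityMeasure → Pred 𝕀 0ℓ → Set (lsuc 0ℓ)
  AlmostEverywhere μ P =
    Σ[ N ∈ Pred 𝕀 0ℓ ] Σ[ b ∈ Borel N ] measure μ b ≈ 0# × (∀ x → x ∉ N → P x)

  -- A collection of open intervals (left i, right i) with endpoints in
  -- [0,1]; `covers` says that the closures [left i, right i] have union
  -- [0,1].
  record TopologicalPartition : Set (lsuc 0ℓ) where
    field
      Index      : Set
      left right : Index → 𝕀

    interval : Index → Pred 𝕀 0ℓ
    interval i = Interval ⟦ left i ⟧ ⟦ right i ⟧

    closure : Index → Pred 𝕀 0ℓ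
    closure i = ClosedInterval ⟦ left i ⟧ ⟦ right i ⟧

    field
      nonempty : ∀ i → ⟦ left i ⟧ < ⟦ right i ⟧
      disjoint : ∀ {i j} → i ≢ j → interval i ⊥ interval j
      covers   : ∀ x → x ∈ ⋃ Index closure

    IsEndpoint : Pred 𝕀 0ℓ
    IsEndpoint x = ∃[ i ] (⟦ x ⟧ ≈ ⟦ left i ⟧ ⊎ ⟦ x ⟧ ≈ ⟦ right i ⟧)

    locate : ∀ x → x ∉ IsEndpoint → ∃[ i ] x ∈ interval i
    locate x x∉ with covers x
    ... | i , l≤x , x≤r =
      i , (l≤x , λ l≈x → x∉ (i , inj₁ (sym l≈x)))
        , (x≤r , λ x≈r → x∉ (i , inj₂ x≈r))

    interval-Borel : ∀ i → Borel (interval i)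
    interval-Borel i =
      open-set λ x x∈ → ⟦ left i ⟧ , ⟦ right i ⟧ , x∈ , λ y∈ → y∈

  open TopologicalPartition

  PartitionSequence : Set (lsuc 0ℓ)
  PartitionSequence = ℕ → TopologicalPartition

  E : PartitionSequence → Pred 𝕀 0ℓ
  E P x = ∃[ n ] x ∈ IsEndpoint (P n)

  -- `I P x x∉E n` is the interval Iₙ(x) of the partition P n; uniqueness is
  -- the disjointness of the intervals.
  module _ (P : PartitionSequence) (x : 𝕀) (x∉E : x ∉ E P) (n : ℕ) where

    cell : ∃[ i ] x ∈ interval (P n) i
    cell = locate (P n) x (λ e → x∉E (n , e))

    I : Pred 𝕀 0ℓ
    I = interval (P n) (proj₁ cell)

    I-Borel : Borel I
    I-Borel = interval-Borel (P n) (proj₁ cell)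

  -- P is log-balanced a.e. with respect to μ, with a.e. weight function f.
  -- Eventual positivity of the measures encodes the convention
  -- - log 0 = +∞, under which the limit could not otherwise be 1.
  record IsWeightFunction (μ : BorelProbabilityMeasure)
                          (P : PartitionSequence)
                          (f : ℕ → Carrier) : Set (lsuc 0ℓ) where
    field
      E-Borel  : Borel (E P)
      E-null   : measure μ E-Borel ≈ 0#
      diverges : f ⟶+∞
      balanced : AlmostEverywhere μ λ x → Σ[ x∉E ∈ x ∉ E P ]
                   let m = λ n → measure μ (I-Borel P x x∉E n) in
                   Eventually (λ n → 0# < m n) ×
                   (λ n → (- log (m n)) / f n) ⟶ 1#

  -- The supremum is taken in ℕ ⁺ = ℕ ∪ {∞}; in particular the supremum of
  -- the empty set is 0.
  IsLochsIndex : (P¹ P² : PartitionSequence) (x : 𝕀) →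
                 x ∉ E P¹ → x ∉ E P² → ℕ → ℕ ⁺ → Set
  IsLochsIndex P¹ P² x x∉E¹ x∉E² n =
    IsSupremum ℕ∞._≤⁺_
      (λ s → ∃[ ℓ ] s ≡ [ ℓ ] × I P¹ x x∉E¹ n ⊆ I P² x x∉E² ℓ)

{-# OPTIONS --safe #-}

-- Upper bound: if I¹ₙ(x) ⊆ I²_L(x), then λ(I¹ₙ(x)) ≤ λ(I²_L(x)), and comparing
-- logarithms gives f₂(L) ≤ (1 + O(η)) f₁(n).
--
-- Lower bound: by (ii) and (iii) there is m = m(n) with f₂(m) between
-- (1 - 4η) f₁(n) and (1 - 3η) f₁(n), and then
-- λ(I¹ₙ(x)) ≤ γ λ(I²ₘ(x)) with γ = e^(-η f₁(n)), for typical x and large n.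
-- If moreover I¹ₙ(x) ⊈ I²ₘ(x), then I¹ₙ(x) contains an endpoint of I²ₘ(x).
-- Cells I of P¹ₙ containing the left (or right) endpoint of some cell J of P²ₘ
-- with λ(I) ≤ γ λ(J) have total measure at most γ, since different I come with
-- different J.  By (i) and the Borel–Cantelli lemma x lies in only finitely
-- many of these sets, so eventually I¹ₙ(x) ⊆ I²ₘ(x) and L ≥ m.

module Submission where

-- Three obstacles shape the details. The exceptional null set must not depend on the accuracy
-- sought, so η runs only through the values 1/(4(k+1)), and countably many null sets are united. A
-- weight function makes the measures of the cells around x positive only for large n, whereas the
-- Lochs index has to be finite for every n; hence the points lying in a null cell of some P¹ₙ are
-- discarded as well. Finally, `log` is an inverse of `exp` with a default value: rather than
-- proving that every positive number is a value of `exp`, the argument uses that the logarithms it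
-- meets are nonzero, which rules out the default. These logarithms are negative, so `exp` is
-- studied on nonpositive arguments only, where its approximants eventually increase and stay below
-- 1.

open import Defs
open import Level using (0ℓ)
open import Algebra.Bundles using (CommutativeRing)
open import Axiom.ExcludedMiddle using (ExcludedMiddle)
open import Data.Empty using (⊥-elim)
open import Data.Integer.Base as ℤ using (ℤ; +0; +[1+_]; -[1+_]; _⊖_)
open import Data.Maybe.Base using (Maybe; just; nothing)
open import Data.Nat.Base as ℕ using (ℕ; zero; suc) renaming (_≤_ to _≤ℕ_)
open import Data.Product.Base using (Σ-syntax; ∃-syntax; _×_; _,_; proj₁; proj₂)
open import Data.Sum.Base using (_⊎_; inj₁; inj₂; [_,_]′)
open import Function.Base using (_∘_)
open import Relation.Binary.Bundles using (TotalOrder)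
open import Relation.Binary.Definitions using (tri<; tri≈; tri>)
open import Relation.Binary.PropositionalEquality.Core as ≡ using (_≡_; _≢_)
open import Relation.Nullary using (¬_; yes; no; contradiction)
open import Relation.Nullary.Construct.Add.Supremum using ([_]; ⊤⁺)
open import Relation.Unary using (Pred; _∈_; _∉_; _⊆_; _≐_; _⊥_; U; ∅; ∁; ⋃; _∩_; _∪_)

import Algebra.Construct.NaturalChoice.Max as Max
import Algebra.Construct.NaturalChoice.MaxOp as MaxOp
import Algebra.Properties.CommutativeSemigroup as CommutativeSemigroupProperties
import Algebra.Properties.CommutativeSemiring.Exp as Exp
import Algebra.Solver.Ring as RingSolver
import Algebra.Solver.Ring.AlmostCommutativeRing as ACR
import Data.Integer.Properties as ℤ
import Data.Nat.Properties as ℕ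
import Relation.Binary.Construct.Add.Supremum.NonStrict ℕ._≤_ as ℕ∞
import Relation.Binary.Construct.NonStrictToStrict as ToStrict
import Relation.Binary.Reasoning.PartialOrder as PosetReasoning
import Relation.Binary.Reasoning.Setoid as SetoidReasoning

-- Ring identities with integer coefficients

-- The solver needs coefficients with computable equality.
module IntegerCoefficientSolver (R : CommutativeRing 0ℓ 0ℓ) where

  open CommutativeRing R
  open import Algebra.Properties.Ring ring
  open import Algebra.Properties.AbelianGroup +-abelianGroup using (⁻¹-∙-comm)
  open SetoidReasoning setoid

  private
    -- The separate case for 1 and the nesting to the left make the constants 1, 3 and 4 of the
    -- solver definitionally `1#`, `3#` and `4#`, so that `refl` closes the solved goals.
    pos : ℕ → Carrier
    pos zero          = 0#
    pos (suc zero)    = 1#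
    pos (suc (suc n)) = pos (suc n) + 1#

    embed : ℤ → Carrier
    embed (ℤ.+ n)  = pos n
    embed -[1+ n ] = - pos (suc n)

    pos-suc : ∀ n → pos (suc n) ≈ 1# + pos n
    pos-suc zero    = sym (+-identityʳ 1#)
    pos-suc (suc n) = +-comm _ _

    pos-+ : ∀ m n → pos (m ℕ.+ n) ≈ pos m + pos n
    pos-+ zero    n = sym (+-identityˡ _)
    pos-+ (suc m) n = begin
      pos (suc (m ℕ.+ n))    ≈⟨ pos-suc (m ℕ.+ n) ⟩
      1# + pos (m ℕ.+ n)     ≈⟨ +-congˡ (pos-+ m n) ⟩
      1# + (pos m + pos n)   ≈⟨ +-assoc _ _ _ ⟨
      1# + pos m + pos n     ≈⟨ +-congʳ (pos-suc m) ⟨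
      pos (suc m) + pos n    ∎

    pos-* : ∀ m n → pos (m ℕ.* n) ≈ pos m * pos n
    pos-* zero    n = sym (zeroˡ _)
    pos-* (suc m) n = begin
      pos (n ℕ.+ m ℕ.* n)          ≈⟨ pos-+ n (m ℕ.* n) ⟩
      pos n + pos (m ℕ.* n)        ≈⟨ +-cong (sym (*-identityˡ _)) (pos-* m n) ⟩
      1# * pos n + pos m * pos n   ≈⟨ distribʳ _ _ _ ⟨
      (1# + pos m) * pos n         ≈⟨ *-congʳ (pos-suc m) ⟨
      pos (suc m) * pos n          ∎

    embed-⊖ : ∀ m n → embed (m ⊖ n) ≈ pos m - pos n
    embed-⊖ m       zero    = sym (trans (+-congˡ -0#≈0#) (+-identityʳ _))
    embed-⊖ zero    (suc n) = sym (+-identityˡ _)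
    embed-⊖ (suc m) (suc n) = begin
      embed (suc m ⊖ suc n)              ≡⟨ ≡.cong embed (ℤ.[1+m]⊖[1+n]≡m⊖n m n) ⟩
      embed (m ⊖ n)                      ≈⟨ embed-⊖ m n ⟩
      pos m - pos n                      ≈⟨ +-identityˡ _ ⟨
      0# + (pos m - pos n)               ≈⟨ +-congʳ (-‿inverseʳ 1#) ⟨
      1# - 1# + (pos m - pos n)          ≈⟨ +-assoc _ _ _ ⟩
      1# + (- 1# + (pos m - pos n))      ≈⟨ +-congˡ (trans (+-congˡ (+-comm _ _)) (sym (+-assoc _ _ _))) ⟩
      1# + (- 1# - pos n + pos m)        ≈⟨ +-congˡ (+-comm _ _) ⟩
      1# + (pos m + (- 1# - pos n))      ≈⟨ +-assoc _ _ _ ⟨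
      1# + pos m + (- 1# - pos n)        ≈⟨ +-cong (sym (pos-suc m))
                                              (trans (⁻¹-∙-comm 1# (pos n)) (-‿cong (sym (pos-suc n)))) ⟩
      pos (suc m) - pos (suc n)          ∎

    embed-+ : ∀ i j → embed (i ℤ.+ j) ≈ embed i + embed j
    embed-+ (ℤ.+ m)  (ℤ.+ n)  = pos-+ m n
    embed-+ (ℤ.+ m)  -[1+ n ] = embed-⊖ m (suc n)
    embed-+ -[1+ m ] (ℤ.+ n)  = trans (embed-⊖ n (suc m)) (+-comm _ _)
    embed-+ -[1+ m ] -[1+ n ] = begin
      - pos (suc (suc (m ℕ.+ n)))    ≡⟨ ≡.cong (λ k → - pos (suc k)) (ℕ.+-suc m n) ⟨
      - pos (suc m ℕ.+ suc n)        ≈⟨ -‿cong (pos-+ (suc m) (suc n)) ⟩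
      - (pos (suc m) + pos (suc n))  ≈⟨ ⁻¹-∙-comm _ _ ⟨
      - pos (suc m) - pos (suc n)    ∎

    embed-neg : ∀ i → embed (ℤ.- i) ≈ - embed i
    embed-neg +0       = sym -0#≈0#
    embed-neg +[1+ n ] = refl
    embed-neg -[1+ n ] = sym (-‿involutive _)

    embed-pos-* : ∀ m j → embed (ℤ.+ m ℤ.* j) ≈ pos m * embed j
    embed-pos-* m (ℤ.+ n)  = trans (reflexive (≡.cong embed (≡.sym (ℤ.pos-* m n)))) (pos-* m n)
    embed-pos-* m -[1+ n ] = begin
      embed (ℤ.+ m ℤ.* -[1+ n ])          ≡⟨ ≡.cong embed (ℤ.neg-distribʳ-* (ℤ.+ m) +[1+ n ]) ⟨
      embed (ℤ.- (ℤ.+ m ℤ.* +[1+ n ]))    ≈⟨ embed-neg (ℤ.+ m ℤ.* +[1+ n ]) ⟩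
      - embed (ℤ.+ m ℤ.* +[1+ n ])        ≈⟨ -‿cong (embed-pos-* m +[1+ n ]) ⟩
      - (pos m * pos (suc n))             ≈⟨ -‿distribʳ-* _ _ ⟩
      pos m * - pos (suc n)               ∎

    embed-* : ∀ i j → embed (i ℤ.* j) ≈ embed i * embed j
    embed-* (ℤ.+ m)  j = embed-pos-* m j
    embed-* -[1+ m ] j = begin
      embed (-[1+ m ] ℤ.* j)          ≡⟨ ≡.cong embed (ℤ.neg-distribˡ-* +[1+ m ] j) ⟨
      embed (ℤ.- (+[1+ m ] ℤ.* j))    ≈⟨ embed-neg (+[1+ m ] ℤ.* j) ⟩
      - embed (+[1+ m ] ℤ.* j)        ≈⟨ -‿cong (embed-pos-* (suc m) j) ⟩
      - (pos (suc m) * embed j)       ≈⟨ -‿distribˡ-* _ _ ⟩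
      - pos (suc m) * embed j         ∎

    embed-≟ : ∀ i j → Maybe (embed i ≈ embed j)
    embed-≟ i j with i ℤ.≟ j
    ... | yes i≡j = just (reflexive (≡.cong embed i≡j))
    ... | no  _   = nothing

    almostCommutativeRing : ACR.AlmostCommutativeRing 0ℓ 0ℓ
    almostCommutativeRing = ACR.fromCommutativeRing R

    morphism : ℤ.+-*-rawRing ACR.-Raw-AlmostCommutative⟶ almostCommutativeRing
    morphism = record
      { ⟦_⟧    = embed
      ; +-homo = embed-+
      ; *-homo = embed-*
      ; -‿homo = embed-neg
      ; 0-homo = refl
      ; 1-homo = refl
      }

    module Solver = RingSolver ℤ.+-*-rawRing almostCommutativeRing morphism embed-≟

  open Solver public using (Polynomial; con; solve; _:=_; _:+_; _:*_; _:-_; :-_)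

  𝟘 𝟙 : ∀ {n} → Polynomial n
  𝟘 = con +0
  𝟙 = con (ℤ.+ 1)

-- Ordered field arithmetic and the Archimedean property

module OrderedField (lem : ExcludedMiddle 0ℓ) (ℝ : CompleteOrderedField) where

  open CompleteOrderedField ℝ public
  open IntegerCoefficientSolver commutativeRing public
  module ≤ = TotalOrder totalOrder
  open ≤ public using (poset; antisym; total)
    renaming (refl to ≤-refl; trans to ≤-trans; reflexive to ≤-reflexive)
  module R = PosetReasoning poset
  module ≈ = SetoidReasoning setoid
  open ToStrict _≈_ _≤_ public using (<⇒≤)
  open CommutativeSemigroupProperties *-commutativeSemigroup public using (x∙yz≈y∙xz)

  ≤-respˡ : ∀ {x y z} → x ≈ y → x ≤ z → y ≤ z
  ≤-respˡ = ≤.≤-respˡ-≈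

  ≤-respʳ : ∀ {x y z} → y ≈ z → x ≤ y → x ≤ z
  ≤-respʳ = ≤.≤-respʳ-≈

  <-irrefl : ∀ {x} → ¬ (x < x)
  <-irrefl (_ , x≉x) = x≉x refl

  <-≤-trans : ∀ {x y z} → x < y → y ≤ z → x < z
  <-≤-trans = ToStrict.<-≤-trans _≈_ _≤_ sym ≤-trans antisym ≤-respʳ

  ≤-<-trans : ∀ {x y z} → x ≤ y → y < z → x < z
  ≤-<-trans = ToStrict.≤-<-trans _≈_ _≤_ ≤-trans antisym ≤-respˡ

  <⇒≱ : ∀ {x y} → x < y → ¬ (y ≤ x)
  <⇒≱ x<y y≤x = <-irrefl (<-≤-trans x<y y≤x)

  ≰⇒> : ∀ {x y} → ¬ (x ≤ y) → y < x
  ≰⇒> {x} {y} x≰y with total x y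
  ... | inj₁ x≤y = contradiction x≤y x≰y
  ... | inj₂ y≤x = y≤x , λ y≈x → x≰y (≤-reflexive (sym y≈x))

  infixl 6 _⊕_
  infixl 7 _⊗_

  _⊗_ : ∀ {x y} → 0# ≤ x → 0# ≤ y → 0# ≤ x * y
  _⊗_ = *-nonNeg

  gap : ∀ {x y} → x ≤ y → 0# ≤ y - x
  gap {x} {y} x≤y = ≤-respˡ (-‿inverseʳ x) (+-monoˡ-≤ (- x) x≤y)

  -- An inequality a ≤ b is proved by exhibiting b - a as a combination of
  -- nonnegative terms, leaving a ring identity to check.
  by-gap : ∀ {a b t} → 0# ≤ t → b ≈ t + a → a ≤ b
  by-gap {a} {b} {t} 0≤t b≈t+a =
    ≤-respˡ (+-identityˡ a) (≤-respʳ (sym b≈t+a) (+-monoˡ-≤ a 0≤t))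

  _⊕_ : ∀ {x y} → 0# ≤ x → 0# ≤ y → 0# ≤ x + y
  0≤x ⊕ 0≤y = ≤-trans 0≤y (by-gap 0≤x refl)

  +-mono-≤ : ∀ {a b c d} → a ≤ b → c ≤ d → a + c ≤ b + d
  +-mono-≤ {a} {b} {c} {d} a≤b c≤d = by-gap (gap a≤b ⊕ gap c≤d)
    (solve 4 (λ a b c d → b :+ d := (b :- a) :+ (d :- c) :+ (a :+ c)) refl a b c d)

  neg-mono-≤ : ∀ {a b} → a ≤ b → - b ≤ - a
  neg-mono-≤ {a} {b} a≤b = by-gap (gap a≤b)
    (solve 2 (λ a b → :- a := (b :- a) :+ (:- b)) refl a b)

  *-monoˡ-≤ : ∀ {a b c} → 0# ≤ c → a ≤ b → c * a ≤ c * b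
  *-monoˡ-≤ {a} {b} {c} 0≤c a≤b = by-gap (0≤c ⊗ gap a≤b)
    (solve 3 (λ a b c → c :* b := c :* (b :- a) :+ c :* a) refl a b c)

  *-monoʳ-≤ : ∀ {a b c} → 0# ≤ c → a ≤ b → a * c ≤ b * c
  *-monoʳ-≤ {a} {b} {c} 0≤c a≤b = ≤-respˡ (*-comm c a) (≤-respʳ (*-comm c b) (*-monoˡ-≤ 0≤c a≤b))

  *-mono-≤ : ∀ {a b c d} → 0# ≤ a → 0# ≤ d → a ≤ b → c ≤ d → a * c ≤ b * d
  *-mono-≤ {a} {b} {c} {d} 0≤a 0≤d a≤b c≤d = by-gap (0≤a ⊗ gap c≤d ⊕ gap a≤b ⊗ 0≤d)
    (solve 4 (λ a b c d → b :* d := a :* (d :- c) :+ (b :- a) :* d :+ a :* c) refl a b c d)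

  neg-nonNeg : ∀ {x} → x ≤ 0# → 0# ≤ - x
  neg-nonNeg {x} x≤0 = ≤-respʳ (+-identityˡ (- x)) (gap x≤0)

  nonNeg-neg : ∀ {x} → 0# ≤ - x → x ≤ 0#
  nonNeg-neg {x} 0≤-x = by-gap 0≤-x (sym (-‿inverseˡ x))

  -0≈0 : - 0# ≈ 0#
  -0≈0 = solve 0 (:- 𝟘 := 𝟘) refl

  neg-nonPos : ∀ {x} → 0# ≤ x → - x ≤ 0#
  neg-nonPos 0≤x = ≤-respʳ -0≈0 (neg-mono-≤ 0≤x)

  0≤square : ∀ x → 0# ≤ x * x
  0≤square x with total 0# x
  ... | inj₁ 0≤x = 0≤x ⊗ 0≤x
  ... | inj₂ x≤0 = ≤-respʳ (solve 1 (λ x → (:- x) :* (:- x) := x :* x) refl x) (neg-nonNeg x≤0 ⊗ neg-nonNeg x≤0)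

  0≤1 : 0# ≤ 1#
  0≤1 = ≤-respʳ (*-identityˡ 1#) (0≤square 1#)

  0<1 : 0# < 1#
  0<1 = 0≤1 , 0≉1

  pos⇒≉0 : ∀ {x} → 0# < x → ¬ (x ≈ 0#)
  pos⇒≉0 (_ , 0≉x) x≈0 = 0≉x (sym x≈0)

  x*x⁻¹≈1 : ∀ {x} → 0# < x → x * x ⁻¹ ≈ 1#
  x*x⁻¹≈1 0<x = *-inverseʳ _ (pos⇒≉0 0<x)

  x<y⇒0<y-x : ∀ {x y} → x < y → 0# < y - x
  x<y⇒0<y-x {x} {y} (x≤y , x≉y) = gap x≤y , λ 0≈y-x → x≉y (begin
    x           ≈⟨ +-identityˡ x ⟨
    0# + x      ≈⟨ +-congʳ 0≈y-x ⟩
    y - x + x   ≈⟨ solve 2 (λ x y → y :- x :+ x := y) refl x y ⟩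
    y           ∎)
    where open ≈

  ⁻¹-pos : ∀ {x} → 0# < x → 0# < x ⁻¹
  ⁻¹-pos {x} 0<x = ≰⇒> λ x⁻¹≤0 → <⇒≱ 0<1 (nonNeg-neg (≤-respʳ
    (trans (solve 2 (λ x y → x :* (:- y) := :- (x :* y)) refl x (x ⁻¹)) (-‿cong (x*x⁻¹≈1 0<x)))
    (<⇒≤ 0<x ⊗ neg-nonNeg x⁻¹≤0)))

  *-cancelˡ-≤ : ∀ {a b c} → 0# < c → c * a ≤ c * b → a ≤ b
  *-cancelˡ-≤ {a} {b} {c} 0<c ca≤cb = ≤-respˡ (cancel a) (≤-respʳ (cancel b) (*-monoˡ-≤ (<⇒≤ (⁻¹-pos 0<c)) ca≤cb))
    where
    cancel : ∀ x → c ⁻¹ * (c * x) ≈ x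
    cancel x = trans (solve 3 (λ c d x → d :* (c :* x) := (c :* d) :* x) refl c (c ⁻¹) x)
      (trans (*-congʳ (x*x⁻¹≈1 0<c)) (*-identityˡ x))

  *-cancelʳ-≤ : ∀ {a b c} → 0# < c → a * c ≤ b * c → a ≤ b
  *-cancelʳ-≤ {a} {b} {c} 0<c ac≤bc = *-cancelˡ-≤ 0<c (≤-respˡ (*-comm a c) (≤-respʳ (*-comm b c) ac≤bc))

  *-pos : ∀ {x y} → 0# < x → 0# < y → 0# < x * y
  *-pos {x} {y} 0<x 0<y = ≰⇒> λ xy≤0 → <⇒≱ 0<y (*-cancelˡ-≤ 0<x (≤-respʳ (sym (zeroʳ x)) xy≤0))

  +-pos-nonNeg : ∀ {x y} → 0# < x → 0# ≤ y → 0# < x + y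
  +-pos-nonNeg {x} {y} 0<x 0≤y = <-≤-trans 0<x (by-gap 0≤y (+-comm x y))

  /-* : ∀ {a c} → 0# < c → (a / c) * c ≈ a
  /-* {a} {c} 0<c = trans (solve 3 (λ a c d → a :* d :* c := a :* (c :* d)) refl a c (c ⁻¹))
    (trans (*-congˡ (x*x⁻¹≈1 0<c)) (*-identityʳ a))

  *≤⇒≤/ : ∀ {a b c} → 0# < c → a * c ≤ b → a ≤ b / c
  *≤⇒≤/ 0<c ac≤b = *-cancelʳ-≤ 0<c (≤-respʳ (sym (/-* 0<c)) ac≤b)

  ≤/⇒*≤ : ∀ {a b c} → 0# < c → a ≤ b / c → a * c ≤ b
  ≤/⇒*≤ 0<c a≤b/c = ≤-respʳ (/-* 0<c) (*-monoʳ-≤ (<⇒≤ 0<c) a≤b/c)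

  ≤*⇒/≤ : ∀ {a b c} → 0# < c → a ≤ b * c → a / c ≤ b
  ≤*⇒/≤ 0<c a≤bc = *-cancelʳ-≤ 0<c (≤-respˡ (sym (/-* 0<c)) a≤bc)

  /≤⇒≤* : ∀ {a b c} → 0# < c → a / c ≤ b → a ≤ b * c
  /≤⇒≤* 0<c a/c≤b = ≤-respˡ (/-* 0<c) (*-monoʳ-≤ (<⇒≤ 0<c) a/c≤b)

  module Maximum = MaxOp (Max.maxOperator totalOrder)

  x≤∣x∣ : ∀ x → x ≤ ∣ x ∣
  x≤∣x∣ x = Maximum.x≤x⊔y x (- x)

  -x≤∣x∣ : ∀ x → - x ≤ ∣ x ∣
  -x≤∣x∣ x = Maximum.x≤y⊔x x (- x)

  ∣∣-lub : ∀ {x y} → x ≤ y → - x ≤ y → ∣ x ∣ ≤ y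
  ∣∣-lub = Maximum.⊔-lub

  nonNeg⇒∣x∣≤x : ∀ {x} → 0# ≤ x → ∣ x ∣ ≤ x
  nonNeg⇒∣x∣≤x 0≤x = ∣∣-lub ≤-refl (≤-trans (neg-nonPos 0≤x) 0≤x)

  ∣x-l∣<ε⇒bounds : ∀ {x l ε} → ∣ x - l ∣ < ε → l - ε ≤ x × x ≤ l + ε
  ∣x-l∣<ε⇒bounds {x} {l} {ε} (≤ε , _) =
      by-gap (gap (≤-trans (-x≤∣x∣ (x - l)) ≤ε))
        (solve 3 (λ x l ε → x := ε :- (:- (x :- l)) :+ (l :- ε)) refl x l ε)
    , by-gap (gap (≤-trans (x≤∣x∣ (x - l)) ≤ε))
        (solve 3 (λ x l ε → l :+ ε := ε :- (x :- l) :+ x) refl x l ε)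

  bounds⇒∣x-l∣≤ε : ∀ {x l ε} → l - ε ≤ x → x ≤ l + ε → ∣ x - l ∣ ≤ ε
  bounds⇒∣x-l∣≤ε {x} {l} {ε} lo hi = ∣∣-lub
    (by-gap (gap hi) (solve 3 (λ x l ε → ε := l :+ ε :- x :+ (x :- l)) refl x l ε))
    (by-gap (gap lo) (solve 3 (λ x l ε → ε := x :- (l :- ε) :+ (:- (x :- l))) refl x l ε))

  2# : Carrier
  2# = 1# + 1#

  0<2 : 0# < 2#
  0<2 = +-pos-nonNeg 0<1 0≤1

  half : Carrier → Carrier
  half x = x * 2# ⁻¹

  half-pos : ∀ {x} → 0# < x → 0# < half x
  half-pos 0<x = *-pos 0<x (⁻¹-pos 0<2)

  half+half : ∀ x → half x + half x ≈ x
  half+half x = trans (solve 2 (λ x h → x :* h :+ x :* h := x :* ((𝟙 :+ 𝟙) :* h)) refl x (2# ⁻¹))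
    (trans (*-congˡ (x*x⁻¹≈1 0<2)) (*-identityʳ x))

  ≤-stable : ∀ {x y} → ¬ (y < x) → x ≤ y
  ≤-stable {x} {y} y≮x with lem {x ≤ y}
  ... | yes x≤y = x≤y
  ... | no  x≰y = contradiction (≰⇒> x≰y) y≮x

  ≤-from-slack : ∀ {x y} → (∀ ε → 0# < ε → x ≤ y + ε) → x ≤ y
  ≤-from-slack {x} {y} h = ≤-stable λ y<x →
    let d = half (x - y)
        0<d = half-pos (x<y⇒0<y-x y<x)
    in <⇒≱ 0<d (nonNeg-neg (≤-respʳ (begin
      y + d - x           ≈⟨ +-congˡ (-‿cong (sym (solve 2 (λ x y → x :- y :+ y := x) refl x y))) ⟩
      y + d - (x - y + y) ≈⟨ +-congˡ (-‿cong (+-congʳ (sym (half+half (x - y))))) ⟩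
      y + d - (d + d + y) ≈⟨ solve 2 (λ y d → y :+ d :- (d :+ d :+ y) := :- d) refl y d ⟩
      - d                 ∎) (gap (h d 0<d))))
    where open ≈

  fromℕ : ℕ → Carrier
  fromℕ n = n · 1#

  0≤fromℕ : ∀ n → 0# ≤ fromℕ n
  0≤fromℕ zero    = ≤-refl
  0≤fromℕ (suc n) = 0≤1 ⊕ 0≤fromℕ n

  0<fromℕ-suc : ∀ n → 0# < fromℕ (suc n)
  0<fromℕ-suc n = +-pos-nonNeg 0<1 (0≤fromℕ n)

  fromℕ-mono-≤ : ∀ {m n} → m ℕ.≤ n → fromℕ m ≤ fromℕ n
  fromℕ-mono-≤ {n = n} ℕ.z≤n = 0≤fromℕ n
  fromℕ-mono-≤ (ℕ.s≤s m≤n)   = +-mono-≤ ≤-refl (fromℕ-mono-≤ m≤n)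

  -- If the naturals were bounded, they would have a supremum s; but n + 1 ≤ s for every n makes s -
  -- 1 a smaller upper bound.
  archimedean : ∀ x → ∃[ n ] x < fromℕ n
  archimedean x with lem {∃[ n ] x < fromℕ n}
  ... | yes found = found
  ... | no  none  = contradiction (least (s - 1#) λ { y (n , ≡.refl) → predecessor n }) s≰s-1
    where
    Naturals : Pred Carrier 0ℓ
    Naturals y = ∃[ n ] y ≡ fromℕ n

    supremum = complete Naturals (0# , 0 , ≡.refl)
      (x , λ { y (n , ≡.refl) → ≤-stable λ x<n → none (n , x<n) })

    s = proj₁ supremum

    least = proj₂ (proj₂ supremum)

    predecessor : ∀ n → fromℕ n ≤ s - 1#
    predecessor n = by-gap (gap (proj₁ (proj₂ supremum) _ (suc n , ≡.refl)))
      (solve 2 (λ s n → s :- 𝟙 := s :- (𝟙 :+ n) :+ n) refl s (fromℕ n))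

    s≰s-1 : ¬ (s ≤ s - 1#)
    s≰s-1 h = <⇒≱ 0<1 (nonNeg-neg (≤-respʳ (solve 1 (λ s → s :- 𝟙 :- s := :- 𝟙) refl s) (gap h)))

  1/_ : ℕ → Carrier
  1/ n = fromℕ n ⁻¹

  1/suc-pos : ∀ n → 0# < 1/ suc n
  1/suc-pos n = ⁻¹-pos (0<fromℕ-suc n)

  archimedean-⁻¹ : ∀ {ε} → 0# < ε → ∃[ n ] 1/ suc n < ε
  archimedean-⁻¹ {ε} 0<ε with archimedean (ε ⁻¹)
  ... | n , ε⁻¹<n = n , ≰⇒> λ ε≤q → <⇒≱ ε⁻¹<n (≤-trans (fromℕ-mono-≤ (ℕ.n≤1+n n)) (*-cancelˡ-≤ 0<ε (begin
    ε * fromℕ (suc n)          ≈⟨ *-comm _ _ ⟩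
    fromℕ (suc n) * ε          ≤⟨ *-monoˡ-≤ (0≤fromℕ (suc n)) ε≤q ⟩
    fromℕ (suc n) * 1/ suc n   ≈⟨ x*x⁻¹≈1 (0<fromℕ-suc n) ⟩
    1#                         ≈⟨ x*x⁻¹≈1 0<ε ⟨
    ε * ε ⁻¹                   ∎)))
    where open R

-- Limits and monotone convergence

module Limits (lem : ExcludedMiddle 0ℓ) (ℝ : CompleteOrderedField) where

  open OrderedField lem ℝ public
  open Analysis lem ℝ public
  dne : {A : Set} → ¬ ¬ A → A
  dne {A} ¬¬a with lem {A}
  ... | yes a  = a
  ... | no  ¬a = contradiction ¬a ¬¬a

  ev-map : ∀ {P Q : Pred ℕ 0ℓ} → (∀ n → P n → Q n) → Eventually P → Eventually Q
  ev-map f (N , p) = N , λ n N≤n → f n (p n N≤n)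

  infixr 3 _∧_

  _∧_ : ∀ {P Q : Pred ℕ 0ℓ} → Eventually P → Eventually Q → Eventually (λ n → P n × Q n)
  (M , p) ∧ (N , q) = M ℕ.⊔ N , λ n MN≤n →
    p n (ℕ.≤-trans (ℕ.m≤m⊔n M N) MN≤n) , q n (ℕ.≤-trans (ℕ.m≤n⊔m M N) MN≤n)

  ev-witness : ∀ {P : Pred ℕ 0ℓ} → Eventually P → ∃[ n ] P n
  ev-witness (N , p) = N , p N ℕ.≤-refl

  ev-∘ : ∀ {P : Pred ℕ 0ℓ} {g : ℕ → ℕ} → (∀ N → Eventually (λ n → N ℕ.≤ g n)) →
         Eventually P → Eventually (P ∘ g)
  ev-∘ g→∞ (N , p) = ev-map (λ n → p _) (g→∞ N)

  half<id : ∀ {ε} → 0# < ε → half ε < ε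
  half<id {ε} 0<ε = ≰⇒> λ ε≤h → <⇒≱ (half-pos 0<ε) (nonNeg-neg (≤-respʳ (≈.begin
    half ε - ε                  ≈.≈⟨ +-congˡ (-‿cong (sym (half+half ε))) ⟩
    half ε - (half ε + half ε)  ≈.≈⟨ solve 1 (λ h → h :- (h :+ h) := :- h) refl (half ε) ⟩
    - half ε                    ≈.∎) (gap ε≤h)))

  module _ {a : ℕ → Carrier} {l : Carrier} (a⟶l : a ⟶ l) where

    limit-bounds : ∀ ε → 0# < ε → Eventually (λ n → l - ε ≤ a n × a n ≤ l + ε)
    limit-bounds ε 0<ε = ev-map (λ n → ∣x-l∣<ε⇒bounds) (a⟶l ε 0<ε)

    limit-≤ : ∀ {c} → Eventually (λ n → a n ≤ c) → l ≤ c
    limit-≤ {c} a≤c = ≤-from-slack λ ε 0<ε →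
      let n , (l-ε≤a , _) , aₙ≤c = ev-witness (limit-bounds ε 0<ε ∧ a≤c) in
      by-gap (gap (≤-trans l-ε≤a aₙ≤c)) (solve 3 (λ l ε c → c :+ ε := c :- (l :- ε) :+ l) refl l ε c)

    limit-≥ : ∀ {c} → Eventually (λ n → c ≤ a n) → c ≤ l
    limit-≥ c≤a = ≤-from-slack λ ε 0<ε →
      let _ , (_ , a≤l+ε) , c≤aₙ = ev-witness (limit-bounds ε 0<ε ∧ c≤a) in
      ≤-trans c≤aₙ a≤l+ε

  limit-unique : ∀ {a l l′} → a ⟶ l → a ⟶ l′ → l ≈ l′
  limit-unique a⟶l a⟶l′ = antisym (below a⟶l a⟶l′) (below a⟶l′ a⟶l)
    where
    below : ∀ {a l l′} → a ⟶ l → a ⟶ l′ → l ≤ l′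
    below {l = l} {l′} a⟶l a⟶l′ = ≤-from-slack λ ε 0<ε →
      by-gap (gap (limit-≥ a⟶l′ (ev-map (λ _ → proj₁) (limit-bounds a⟶l ε 0<ε))))
        (solve 3 (λ l l′ ε → l′ :+ ε := l′ :- (l :- ε) :+ l) refl l l′ ε)

  lim-≈ : ∀ {a l} → a ⟶ l → lim a ≈ l
  lim-≈ {a} {l} a⟶l with lem {∃[ l ] a ⟶ l}
  ... | yes (_ , a⟶l′) = limit-unique a⟶l′ a⟶l
  ... | no  diverges    = contradiction (l , a⟶l) diverges

  module _ {a : ℕ → Carrier} {c : Carrier} (N : ℕ)
           (increasing : ∀ n → N ℕ.≤ n → a n ≤ a (suc n))
           (bounded : ∀ n → N ℕ.≤ n → a n ≤ c) where

    increasing⇒mono : ∀ {m n} → N ℕ.≤ m → m ℕ.≤′ n → a m ≤ a n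
    increasing⇒mono N≤m ℕ.≤′-refl       = ≤-refl
    increasing⇒mono N≤m (ℕ.≤′-step m≤n) =
      ≤-trans (increasing⇒mono N≤m m≤n) (increasing _ (ℕ.≤-trans N≤m (ℕ.≤′⇒≤ m≤n)))

    -- The hypotheses start at `N` because the approximants of `exp x` are known to increase only
    -- once their bases are nonnegative.
    monotone-convergence : ∃[ l ] a ⟶ l × (∀ n → N ℕ.≤ n → a n ≤ l)
    monotone-convergence = s , converges , below
      where
      Values : Pred Carrier 0ℓ
      Values y = ∃[ n ] N ℕ.≤ n × y ≡ a n

      supremum = complete Values (a N , N , ℕ.≤-refl , ≡.refl)
        (c , λ { _ (n , N≤n , ≡.refl) → bounded n N≤n })

      s = proj₁ supremum

      below : ∀ n → N ℕ.≤ n → a n ≤ s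
      below n N≤n = proj₁ (proj₂ supremum) _ (n , N≤n , ≡.refl)

      close : ∀ δ → 0# < δ → ∃[ n ] N ℕ.≤ n × s - δ ≤ a n
      close δ 0<δ = dne λ none → <⇒≱ 0<δ (nonNeg-neg (≤-respʳ
        (solve 2 (λ s δ → s :- δ :- s := :- δ) refl s δ)
        (gap (proj₂ (proj₂ supremum) (s - δ) λ { _ (n , N≤n , ≡.refl) →
          ≤-stable λ s-δ<aₙ → none (n , N≤n , <⇒≤ s-δ<aₙ) }))))

      converges : a ⟶ s
      -- The bounds obtained are non-strict; aiming at `half ε` restores the strict inequality in
      -- the definition of the limit.
      converges ε 0<ε = let n , N≤n , s-δ≤aₙ = close (half ε) (half-pos 0<ε) in
        n , λ m n≤m → ≤-<-trans
          (bounds⇒∣x-l∣≤ε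
            (≤-trans s-δ≤aₙ (increasing⇒mono N≤n (ℕ.≤⇒≤′ n≤m)))
            (≤-trans (below m (ℕ.≤-trans N≤n n≤m))
              (by-gap (<⇒≤ (half-pos 0<ε)) (+-comm s (half ε)))))
          (half<id 0<ε)

  -- Powers, and the exponential on nonpositive arguments

  ^-nonNeg : ∀ {x} n → 0# ≤ x → 0# ≤ x ^ n
  ^-nonNeg zero    0≤x = 0≤1
  ^-nonNeg (suc n) 0≤x = 0≤x ⊗ ^-nonNeg n 0≤x

  ^-pos : ∀ {x} n → 0# < x → 0# < x ^ n
  ^-pos zero    0<x = 0<1
  ^-pos (suc n) 0<x = *-pos 0<x (^-pos n 0<x)

  ^-monoˡ-≤ : ∀ {x y} n → 0# ≤ x → x ≤ y → x ^ n ≤ y ^ n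
  ^-monoˡ-≤ zero    0≤x x≤y = ≤-refl
  ^-monoˡ-≤ (suc n) 0≤x x≤y = *-mono-≤ 0≤x (^-nonNeg n (≤-trans 0≤x x≤y)) x≤y (^-monoˡ-≤ n 0≤x x≤y)

  1^n≈1 : ∀ n → 1# ^ n ≈ 1#
  1^n≈1 zero    = refl
  1^n≈1 (suc n) = trans (*-identityˡ _) (1^n≈1 n)

  -- Convexity of a power, as Bernoulli's inequality without division. In the induction, multiplying
  -- the previous bound by u leaves the error k vⁿ (u - v)², which is nonnegative.
  tangent-≤ : ∀ {u v} n → 0# ≤ u → 0# ≤ v →
              v ^ suc n + fromℕ (suc n) * (v ^ n * (u - v)) ≤ u ^ suc n
  tangent-≤ {u} {v} zero    0≤u 0≤v = ≤-reflexive
    (solve 2 (λ u v → v :* 𝟙 :+ (𝟙 :+ 𝟘) :* (𝟙 :* (u :- v)) := u :* 𝟙) refl u v)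
  tangent-≤ {u} {v} (suc n) 0≤u 0≤v = by-gap
    (0≤u ⊗ gap (tangent-≤ n 0≤u 0≤v) ⊕ 0≤fromℕ (suc n) ⊗ (^-nonNeg n 0≤v ⊗ 0≤square (u - v)))
    (solve 5 (λ u v U V k →
        u :* U := u :* (U :- (v :* V :+ k :* (V :* (u :- v))))
                  :+ k :* (V :* ((u :- v) :* (u :- v)))
                  :+ (v :* (v :* V) :+ (𝟙 :+ k) :* (v :* V :* (u :- v))))
      refl u v (u ^ suc n) (v ^ n) (fromℕ (suc n)))

  exp-base : Carrier → ℕ → Carrier
  exp-base x n = 1# + x / fromℕ (suc n)

  exp-term : Carrier → ℕ → Carrier
  exp-term x n = exp-base x n ^ suc n

  k*k⁻¹≈1 : ∀ n → fromℕ (suc n) * 1/ suc n ≈ 1#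
  k*k⁻¹≈1 n = x*x⁻¹≈1 (0<fromℕ-suc n)

  exp-base-pos : ∀ x → Eventually (λ n → 0# < exp-base x n)
  exp-base-pos x = let N , -x<N = archimedean (- x) in N , λ n N≤n →
    let k = fromℕ (suc n) in
    <-≤-trans
      (*-pos (x<y⇒0<y-x (<-≤-trans -x<N (fromℕ-mono-≤ (ℕ.m≤n⇒m≤1+n N≤n)))) (1/suc-pos n))
      (≤-reflexive (trans
        (solve 3 (λ x k q → (k :- (:- x)) :* q := k :* q :+ x :* q) refl x k (1/ suc n))
        (+-congʳ (k*k⁻¹≈1 n))))

  exp-base-≤1 : ∀ {x} n → x ≤ 0# → exp-base x n ≤ 1#
  exp-base-≤1 {x} n x≤0 = by-gap (neg-nonNeg x≤0 ⊗ <⇒≤ (1/suc-pos n))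
    (solve 2 (λ x q → 𝟙 := (:- x) :* q :+ (𝟙 :+ x :* q)) refl x (1/ suc n))

  exp-term-≤1 : ∀ {x} n → x ≤ 0# → 0# ≤ exp-base x n → exp-term x n ≤ 1#
  exp-term-≤1 n x≤0 0≤b = ≤-respʳ (1^n≈1 (suc n)) (^-monoˡ-≤ (suc n) 0≤b (exp-base-≤1 n x≤0))

  exp-base-slope : ∀ x y n → fromℕ (suc n) * (exp-base y n - exp-base x n) ≈ y - x
  exp-base-slope x y n = trans
    (solve 4 (λ x y k q → k :* (𝟙 :+ y :* q :- (𝟙 :+ x :* q)) := (k :* q) :* (y :- x))
      refl x y (fromℕ (suc n)) (1/ suc n))
    (trans (*-congʳ (k*k⁻¹≈1 n)) (*-identityˡ _))

  -- The new base is the mean of `suc n` copies of the old one and a single 1, as in the proof by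
  -- AM-GM that the approximants increase.
  exp-base-suc : ∀ x n → fromℕ (suc (suc n)) * (exp-base x (suc n) - exp-base x n) ≈ 1# - exp-base x n
  exp-base-suc x n = begin
    (1# + k) * (1# + x * q′ - (1# + x * q))
      ≈⟨ solve 4 (λ x k q q′ → (𝟙 :+ k) :* (𝟙 :+ x :* q′ :- (𝟙 :+ x :* q)) :=
           x :* ((𝟙 :+ k) :* q′) :- x :* q :- x :* (k :* q)) refl x k q q′ ⟩
    x * ((1# + k) * q′) - x * q - x * (k * q)
      ≈⟨ +-cong (+-congʳ (*-congˡ (k*k⁻¹≈1 (suc n)))) (-‿cong (*-congˡ (k*k⁻¹≈1 n))) ⟩
    x * 1# - x * q - x * 1#
      ≈⟨ solve 2 (λ x q → x :* 𝟙 :- x :* q :- x :* 𝟙 := 𝟙 :- (𝟙 :+ x :* q)) refl x q ⟩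
    1# - (1# + x * q) ∎
    where
    open ≈
    k = fromℕ (suc n)
    q = 1/ suc n
    q′ = 1/ suc (suc n)

  -- By `exp-base-suc`, the tangent at the old base, evaluated at the new base, is exactly the old
  -- term.
  exp-term-increasing : ∀ x n → 0# ≤ exp-base x n → 0# ≤ exp-base x (suc n) →
                        exp-term x n ≤ exp-term x (suc n)
  exp-term-increasing x n 0≤v 0≤u = ≤-respˡ (begin
    v * V + k′ * (V * (u - v))  ≈⟨ +-congˡ (x∙yz≈y∙xz k′ V (u - v)) ⟩
    v * V + V * (k′ * (u - v))  ≈⟨ +-congˡ (*-congˡ (exp-base-suc x n)) ⟩
    v * V + V * (1# - v)        ≈⟨ solve 2 (λ v V → v :* V :+ V :* (𝟙 :- v) := V) refl v V ⟩
    V                           ∎)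
    (tangent-≤ (suc n) 0≤u 0≤v)
    where
    open ≈
    u = exp-base x (suc n)
    v = exp-base x n
    V = exp-term x n
    k′ = fromℕ (suc (suc n))

  module _ {x} (x≤0 : x ≤ 0#) where

    private
      N = proj₁ (exp-base-pos x)

      base-nonNeg : ∀ n → N ℕ.≤ n → 0# ≤ exp-base x n
      base-nonNeg n N≤n = <⇒≤ (proj₂ (exp-base-pos x) n N≤n)

      convergence = monotone-convergence N
        (λ n N≤n → exp-term-increasing x n (base-nonNeg n N≤n) (base-nonNeg (suc n) (ℕ.m≤n⇒m≤1+n N≤n)))
        (λ n N≤n → exp-term-≤1 n x≤0 (base-nonNeg n N≤n))

      exp≈limit : exp x ≈ proj₁ convergence
      exp≈limit = lim-≈ (proj₁ (proj₂ convergence))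

    exp-≤ : ∀ {c} → Eventually (λ n → exp-term x n ≤ c) → exp x ≤ c
    exp-≤ h = ≤-respˡ (sym exp≈limit) (limit-≤ (proj₁ (proj₂ convergence)) h)

    exp-term-≤-exp : Eventually (λ n → exp-term x n ≤ exp x)
    exp-term-≤-exp = N , λ n N≤n → ≤-respʳ (sym exp≈limit) (proj₂ (proj₂ convergence) n N≤n)

    exp-pos : 0# < exp x
    exp-pos = let n , 0<b , t≤exp = ev-witness (exp-base-pos x ∧ exp-term-≤-exp) in
      <-≤-trans (^-pos (suc n) 0<b) t≤exp

    exp-≤1 : exp x ≤ 1#
    exp-≤1 = exp-≤ (ev-map (λ n 0<b → exp-term-≤1 n x≤0 (<⇒≤ 0<b)) (exp-base-pos x))

  -- The tangent line of `exp` at x, obtained from the tangents of the approximants. Monotonicity,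
  -- cancellation and decay of `exp` all follow from this one estimate.
  exp-growth : ∀ {x y} → x ≤ y → y ≤ 0# → exp x * (1# + (y - x)) ≤ exp y
  exp-growth {x} {y} x≤y y≤0 = ≤/⇒*≤ 0<c (exp-≤ x≤0 (ev-map
    (λ n (0<v , 0<u , t≤exp) → *≤⇒≤/ 0<c (≤-trans (growth n (<⇒≤ 0<v) (<⇒≤ 0<u)) t≤exp))
    (exp-base-pos x ∧ exp-base-pos y ∧ exp-term-≤-exp y≤0)))
    where
    open R
    x≤0 = ≤-trans x≤y y≤0

    0<c : 0# < 1# + (y - x)
    0<c = +-pos-nonNeg 0<1 (gap x≤y)

    growth : ∀ n → 0# ≤ exp-base x n → 0# ≤ exp-base y n → exp-term x n * (1# + (y - x)) ≤ exp-term y n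
    growth n 0≤v 0≤u = begin
      v * V * (1# + (y - x))        ≤⟨ by-gap (^-nonNeg n 0≤v ⊗ gap (exp-base-≤1 n x≤0) ⊗ gap x≤y)
                                        (solve 4 (λ v V x y →
                                          v :* V :+ V :* (y :- x)
                                            := V :* (𝟙 :- v) :* (y :- x) :+ v :* V :* (𝟙 :+ (y :- x)))
                                          refl v V x y) ⟩
      v * V + V * (y - x)           ≈⟨ +-congˡ (*-congˡ (exp-base-slope x y n)) ⟨
      v * V + V * (k * (u - v))     ≈⟨ +-congˡ (x∙yz≈y∙xz k V (u - v)) ⟨
      v * V + k * (V * (u - v))     ≤⟨ tangent-≤ n 0≤u 0≤v ⟩
      exp-term y n                  ∎
      where
      u = exp-base y n
      v = exp-base x n
      V = v ^ n
      k = fromℕ (suc n)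

  exp-mono-≤ : ∀ {x y} → x ≤ y → y ≤ 0# → exp x ≤ exp y
  exp-mono-≤ {x} {y} x≤y y≤0 = ≤-trans
    (by-gap (<⇒≤ (exp-pos (≤-trans x≤y y≤0)) ⊗ gap x≤y)
      (solve 3 (λ e x y → e :* (𝟙 :+ (y :- x)) := e :* (y :- x) :+ e) refl (exp x) x y))
    (exp-growth x≤y y≤0)

  exp-cancel-≤ : ∀ {x y} → x ≤ 0# → exp x ≤ exp y → x ≤ y
  exp-cancel-≤ {x} {y} x≤0 ex≤ey = ≤-stable λ y<x →
    <⇒≱ (*-pos (exp-pos (≤-trans (<⇒≤ y<x) x≤0)) (x<y⇒0<y-x y<x))
      (nonNeg-neg (≤-respʳ
        (solve 3 (λ e x y → e :- e :* (𝟙 :+ (x :- y)) := :- (e :* (x :- y))) refl (exp y) x y)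
        (gap (≤-trans (exp-growth (<⇒≤ y<x) x≤0) ex≤ey))))

  -- The product of the bases for x and y exceeds the base for x + y by xy/k², which is nonnegative
  -- because x and y have the same sign.
  exp-+-≤ : ∀ {x y} → x ≤ 0# → y ≤ 0# → exp (x + y) ≤ exp x * exp y
  exp-+-≤ {x} {y} x≤0 y≤0 = exp-≤ x+y≤0 (ev-map
    (λ n (0<b , 0<u , 0<v , tx≤ , ty≤) → begin
      exp-base (x + y) n ^ suc n                ≤⟨ ^-monoˡ-≤ (suc n) (<⇒≤ 0<b) (base-≤ n) ⟩
      (exp-base x n * exp-base y n) ^ suc n     ≈⟨ Exp.^-distrib-* commutativeSemiring (exp-base x n) (exp-base y n) (suc n) ⟩
      exp-term x n * exp-term y n               ≤⟨ *-mono-≤ (^-nonNeg (suc n) (<⇒≤ 0<u)) (<⇒≤ (exp-pos y≤0)) tx≤ ty≤ ⟩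
      exp x * exp y                             ∎)
    (exp-base-pos (x + y) ∧ exp-base-pos x ∧ exp-base-pos y ∧ exp-term-≤-exp x≤0 ∧ exp-term-≤-exp y≤0))
    where
    open R
    x+y≤0 : x + y ≤ 0#
    x+y≤0 = ≤-respʳ (+-identityˡ 0#) (+-mono-≤ x≤0 y≤0)

    base-≤ : ∀ n → exp-base (x + y) n ≤ exp-base x n * exp-base y n
    base-≤ n = by-gap (neg-nonNeg x≤0 ⊗ neg-nonNeg y≤0 ⊗ 0≤square (1/ suc n))
      (solve 3 (λ x y q → (𝟙 :+ x :* q) :* (𝟙 :+ y :* q) := (:- x) :* (:- y) :* (q :* q) :+ (𝟙 :+ (x :+ y) :* q))
        refl x y (1/ suc n))

  -- Growth from x up to 0 gives exp x (1 - x) ≤ 1, which contradicts c ≤ exp x as soon as - x ≥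
  -- 1/c.
  exp-small : ∀ {c} → 0# < c → ∃[ M ] (∀ {x} → x ≤ - M → exp x < c)
  exp-small {c} 0<c = M , λ {x} x≤-M → ≰⇒> λ c≤ex →
    let x≤0 = ≤-trans x≤-M (neg-nonPos (<⇒≤ 0<M))
        c[1-x]≤1 = ≤-trans (≤-trans
          (*-mono-≤ (<⇒≤ 0<c) (0≤1 ⊕ gap x≤0) c≤ex ≤-refl)
          (exp-growth x≤0 ≤-refl)) (exp-≤1 ≤-refl)
    in <⇒≱ 0<c (nonNeg-neg (begin
      0#                                              ≤⟨ gap c[1-x]≤1 ⊕ <⇒≤ 0<c ⊗ gap x≤-M ⟩
      1# - c * (1# + (0# - x)) + c * (- M - x)        ≈⟨ solve 3 (λ c x M →
                                                            𝟙 :- c :* (𝟙 :+ (𝟘 :- x)) :+ c :* (:- M :- x)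
                                                              := 𝟙 :- c :* M :- c) refl c x M ⟩
      1# - c * M - c                                  ≈⟨ +-congʳ (+-congˡ (-‿cong (x*x⁻¹≈1 0<c))) ⟩
      1# - 1# - c                                     ≈⟨ solve 1 (λ c → 𝟙 :- 𝟙 :- c := :- c) refl c ⟩
      - c                                             ∎))
    where
    open R
    M = c ⁻¹
    0<M = ⁻¹-pos 0<c

  -- A nonzero value of `log` cannot be the default, so it comes from an actual preimage under
  -- `exp`.
  exp-log : ∀ {y} → ¬ (log y ≈ 0#) → exp (log y) ≈ y
  exp-log {y} log≉0 with lem {∃[ x ] exp x ≈ y}
  ... | yes (_ , ex≈y) = ex≈y
  ... | no  _          = contradiction refl log≉0

-- Series, countable subadditivity and the Borel-Cantelli lemma

module Measure (lem : ExcludedMiddle 0ℓ) (ℝ : CompleteOrderedField) where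

  open Limits lem ℝ public

  partialSum-mono : ∀ {a b : ℕ → Carrier} → (∀ n → a n ≤ b n) → ∀ n → partialSum a n ≤ partialSum b n
  partialSum-mono a≤b zero    = ≤-refl
  partialSum-mono a≤b (suc n) = +-mono-≤ (a≤b 0) (partialSum-mono (a≤b ∘ suc) n)

  partialSum-nonNeg : ∀ {a : ℕ → Carrier} → (∀ n → 0# ≤ a n) → ∀ n → 0# ≤ partialSum a n
  partialSum-nonNeg 0≤a zero    = ≤-refl
  partialSum-nonNeg 0≤a (suc n) = 0≤a 0 ⊕ partialSum-nonNeg (0≤a ∘ suc) n

  partialSum-nonPos : ∀ {a : ℕ → Carrier} → (∀ n → a n ≤ 0#) → ∀ n → partialSum a n ≤ 0#
  partialSum-nonPos a≤0 zero    = ≤-refl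
  partialSum-nonPos a≤0 (suc n) = ≤-respʳ (+-identityˡ 0#) (+-mono-≤ (a≤0 0) (partialSum-nonPos (a≤0 ∘ suc) n))

  partialSum-* : ∀ c (a : ℕ → Carrier) n → partialSum (λ k → c * a k) n ≈ c * partialSum a n
  partialSum-* c a zero    = sym (zeroʳ c)
  partialSum-* c a (suc n) = trans (+-congˡ (partialSum-* c (a ∘ suc) n)) (sym (distribˡ c _ _))

  partialSum-+ : ∀ (a : ℕ → Carrier) m n →
                 partialSum a (m ℕ.+ n) ≈ partialSum a m + partialSum (λ k → a (m ℕ.+ k)) n
  partialSum-+ a zero    n = sym (+-identityˡ _)
  partialSum-+ a (suc m) n = trans (+-congˡ (partialSum-+ (a ∘ suc) m n)) (sym (+-assoc _ _ _))

  tail-≤ : ∀ {a : ℕ → Carrier} {s} → partialSum a ⟶ s → ∀ N → (∀ k → 0# ≤ a (N ℕ.+ k)) →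
           ∀ n → partialSum (λ k → a (N ℕ.+ k)) n ≤ s - partialSum a N
  tail-≤ {a} {s} converges N 0≤a n = by-gap (gap (limit-≥ converges (N ℕ.+ n , later)))
    (solve 3 (λ s p t → s :- p := s :- (p :+ t) :+ t) refl s (partialSum a N) (partialSum (λ k → a (N ℕ.+ k)) n))
    where
    later : ∀ m → N ℕ.+ n ℕ.≤ m → partialSum a N + partialSum (λ k → a (N ℕ.+ k)) n ≤ partialSum a m
    later m N+n≤m = ≤-respʳ
      (reflexive (≡.cong (partialSum a) (≡.trans (≡.sym (ℕ.+-assoc N n d)) (ℕ.m+[n∸m]≡n N+n≤m))))
      (≤-respʳ (sym (trans (partialSum-+ a N (n ℕ.+ d)) (+-congˡ (partialSum-+ (λ k → a (N ℕ.+ k)) n d))))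
        (by-gap (partialSum-nonNeg (λ k → 0≤a (n ℕ.+ k)) d)
          (solve 3 (λ p t r → p :+ (t :+ r) := r :+ (p :+ t)) refl _ _ _)))
      where d = m ℕ.∸ (N ℕ.+ n)

  partialSum-≤-limit : ∀ {a : ℕ → Carrier} {s} → partialSum a ⟶ s → (∀ k → 0# ≤ a k) →
                       ∀ n → partialSum a n ≤ s
  partialSum-≤-limit {s = s} converges 0≤a n =
    ≤-respʳ (solve 1 (λ s → s :- 𝟘 := s) refl s) (tail-≤ converges 0 0≤a n)

  _⟨or⟩_ : ∀ {A : Set₁} → A → A → ℕ → A
  (A ⟨or⟩ B) zero    = A
  (A ⟨or⟩ B) (suc _) = B

  Borel-∅ : Borel ∅
  Borel-∅ = open-set λ x ()

  Borel-∪ : ∀ {A B} → Borel A → Borel B → Borel (A ∪ B)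
  Borel-∪ {A} {B} a b = resp
    ( (λ { (zero , x∈A) → inj₁ x∈A ; (suc _ , x∈B) → inj₂ x∈B })
    , (λ { (inj₁ x∈A) → 0 , x∈A ; (inj₂ x∈B) → 1 , x∈B }))
    (union {A ⟨or⟩ B} λ { zero → a ; (suc _) → b })

  Borel-∩∁ : ∀ {A B} → Borel A → Borel B → Borel (A ∩ ∁ B)
  Borel-∩∁ {A} {B} a b = resp
    ( (λ ¬[∁A∪B] → dne (¬[∁A∪B] ∘ inj₁) , ¬[∁A∪B] ∘ inj₂)
    , (λ { (x∈A , x∉B) → [ (λ x∉A → x∉A x∈A) , x∉B ]′ }))
    (complement (Borel-∪ (complement a) b))

  module _ (μ : BorelProbabilityMeasure) where

    measure-⊥-≤ : ∀ {A : ℕ → Pred 𝕀 0ℓ} (a : ∀ n → Borel (A n)) → (∀ {m n} → m ≢ n → A m ⊥ A n) →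
                  ∀ n → partialSum (λ k → measure μ (a k)) n ≤ measure μ (union a)
    measure-⊥-≤ a disjoint = partialSum-≤-limit (measure-additive μ a disjoint) (measure-nonNeg μ ∘ a)

    -- Additivity is available for sequences only, so B is split into A, `B ∩ ∁ A` and infinitely
    -- many empty sets; the partial sum of length 1 is the measure of A.
    measure-mono : ∀ {A B} (a : Borel A) (b : Borel B) → A ⊆ B → measure μ a ≤ measure μ b
    measure-mono {A} {B} a b A⊆B = begin
      measure μ a              ≈⟨ +-identityʳ _ ⟨
      measure μ a + 0#         ≤⟨ measure-⊥-≤ piece-Borel disjoint 1 ⟩
      measure μ (union piece-Borel)  ≈⟨ measure-cong μ _ b (into , out) ⟩
      measure μ b              ∎
      where
      open R
      piece : ℕ → Pred 𝕀 0ℓ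
      piece 0             = A
      piece 1             = B ∩ ∁ A
      piece (suc (suc _)) = ∅

      piece-Borel : ∀ n → Borel (piece n)
      piece-Borel 0             = a
      piece-Borel 1             = Borel-∩∁ b a
      piece-Borel (suc (suc _)) = Borel-∅

      disjoint : ∀ {m n} → m ≢ n → piece m ⊥ piece n
      disjoint {0} {0} m≢n _ = m≢n ≡.refl
      disjoint {0} {1} m≢n (x∈A , _ , x∉A) = x∉A x∈A
      disjoint {1} {0} m≢n ((_ , x∉A) , x∈A) = x∉A x∈A
      disjoint {1} {1} m≢n _ = m≢n ≡.refl
      disjoint {0} {suc (suc _)} m≢n (_ , ())
      disjoint {1} {suc (suc _)} m≢n (_ , ())
      disjoint {suc (suc _)} m≢n (() , _)

      into : ⋃ ℕ piece ⊆ B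
      into (0 , x∈A)       = A⊆B x∈A
      into (1 , x∈B , _)   = x∈B
      into (suc (suc _) , ())

      out : B ⊆ ⋃ ℕ piece
      out {x} x∈B with lem {x ∈ A}
      ... | yes x∈A = 0 , x∈A
      ... | no  x∉A = 1 , x∈B , x∉A

    measure-≤1 : ∀ {A} (a : Borel A) → measure μ a ≤ 1#
    measure-≤1 a = ≤-respʳ (measure-U μ Borel-U) (measure-mono a Borel-U _)
      where
      Borel-U : Borel U
      Borel-U = resp ((λ _ → _) , λ _ ()) (complement Borel-∅)

    -- Removing the earlier sets from each one makes the family disjoint. Bounding partial sums,
    -- instead of comparing with a sum, spares the question whether the series of measures
    -- converges.
    measure-⋃-≤ : ∀ {A : ℕ → Pred 𝕀 0ℓ} (a : ∀ n → Borel (A n)) {c} →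
                  (∀ n → partialSum (λ k → measure μ (a k)) n ≤ c) → measure μ (union a) ≤ c
    measure-⋃-≤ {A} a {c} bound = ≤-respˡ
      (measure-cong μ _ _ ((λ (n , x∈A , _) → n , x∈A) , λ (n , x∈A) → first (suc n) (inj₂ x∈A)))
      (limit-≤ (measure-additive μ new-Borel new-disjoint)
        (0 , λ n _ → ≤-trans (partialSum-mono (λ k → measure-mono (new-Borel k) (a k) proj₁) n) (bound n)))
      where
      earlier : ℕ → Pred 𝕀 0ℓ
      earlier zero    = ∅
      earlier (suc n) = earlier n ∪ A n

      earlier-Borel : ∀ n → Borel (earlier n)
      earlier-Borel zero    = Borel-∅
      earlier-Borel (suc n) = Borel-∪ (earlier-Borel n) (a n)

      new : ℕ → Pred 𝕀 0ℓ
      new n = A n ∩ ∁ (earlier n)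

      new-Borel : ∀ n → Borel (new n)
      new-Borel n = Borel-∩∁ (a n) (earlier-Borel n)

      before : ∀ {m n} → m ℕ.<′ n → A m ⊆ earlier n
      before ℕ.≤′-refl       x∈A = inj₂ x∈A
      before (ℕ.≤′-step m<n) x∈A = inj₁ (before m<n x∈A)

      new-disjoint : ∀ {m n} → m ≢ n → new m ⊥ new n
      new-disjoint {m} {n} m≢n ((x∈Aₘ , x∉earlierₘ) , (x∈Aₙ , x∉earlierₙ)) with ℕ.<-cmp m n
      ... | tri< m<n _ _ = x∉earlierₙ (before (ℕ.≤⇒≤′ m<n) x∈Aₘ)
      ... | tri≈ _ m≡n _ = m≢n m≡n
      ... | tri> _ _ n<m = x∉earlierₘ (before (ℕ.≤⇒≤′ n<m) x∈Aₙ)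

      first : ∀ n → earlier n ⊆ ⋃ ℕ new
      first (suc n) (inj₁ x∈earlier) = first n x∈earlier
      first (suc n) {x} (inj₂ x∈A) with lem {x ∈ earlier n}
      ... | yes x∈earlier = first n x∈earlier
      ... | no  x∉earlier = n , x∈A , x∉earlier

    null-⋃ : ∀ {A : ℕ → Pred 𝕀 0ℓ} (a : ∀ n → Borel (A n)) → (∀ n → measure μ (a n) ≤ 0#) →
             measure μ (union a) ≤ 0#
    null-⋃ a null = measure-⋃-≤ a (partialSum-nonPos null)

    ≤0⇒null : ∀ {A} (a : Borel A) → measure μ a ≤ 0# → measure μ a ≈ 0#
    ≤0⇒null a a≤0 = antisym a≤0 (measure-nonNeg μ a)

    ae-map : ∀ {P Q : Pred 𝕀 0ℓ} → P ⊆ Q → AlmostEverywhere μ P → AlmostEverywhere μ Q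
    ae-map f (N , b , null , p) = N , b , null , λ x x∉N → f (p x x∉N)

    ae-∀ : ∀ {P : ℕ → Pred 𝕀 0ℓ} → (∀ k → AlmostEverywhere μ (P k)) →
           AlmostEverywhere μ (λ x → ∀ k → P k x)
    ae-∀ p = ⋃ ℕ (proj₁ ∘ p) , union (proj₁ ∘ proj₂ ∘ p)
      , ≤0⇒null (union _) (null-⋃ _ (λ k → ≤-reflexive (proj₁ (proj₂ (proj₂ (p k))))))
      , λ x x∉⋃ k → proj₂ (proj₂ (proj₂ (p k))) x (λ x∈N → x∉⋃ (k , x∈N))

    ae-× : ∀ {P Q : Pred 𝕀 0ℓ} → AlmostEverywhere μ P → AlmostEverywhere μ Q →
           AlmostEverywhere μ (λ x → P x × Q x)
    ae-× {P} {Q} p q = ae-map (λ h → h 0 , h 1) (ae-∀ {P ⟨or⟩ Q} λ { zero → p ; (suc _) → q })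

    -- The limsup set lies in every tail union, whose measure is at most the remainder of the
    -- convergent series.
    borel-cantelli : ∀ {D : ℕ → Pred 𝕀 0ℓ} (d : ∀ n → Borel (D n)) {e} → Summable e →
                     Eventually (λ n → measure μ (d n) ≤ e n) →
                     AlmostEverywhere μ λ x → Eventually (λ n → x ∉ D n)
    borel-cantelli {D} d {e} (s , converges) (N₀ , d≤e) =
      -- The intersection of all tails, expressed by the two operations that generate the Borel
      -- sets.
      ∁ (⋃ ℕ (∁ ∘ Tail)) , limsup-Borel , ≤0⇒null limsup-Borel (≤-from-slack small) , λ x x∉limsup →
        let N , x∉Tail = dne x∉limsup in
        N , λ n N≤n x∈D → x∉Tail (n ℕ.∸ N , ≡.subst (λ k → x ∈ D k) (≡.sym (ℕ.m+[n∸m]≡n N≤n)) x∈D)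
      where
      Tail : ℕ → Pred 𝕀 0ℓ
      Tail N = ⋃ ℕ (λ k → D (N ℕ.+ k))

      Tail-Borel : ∀ N → Borel (Tail N)
      Tail-Borel N = union (λ k → d (N ℕ.+ k))

      limsup-Borel : Borel (∁ (⋃ ℕ (∁ ∘ Tail)))
      limsup-Borel = complement (union (complement ∘ Tail-Borel))

      small : ∀ ε → 0# < ε → measure μ limsup-Borel ≤ 0# + ε
      -- Going beyond `N₀` also makes the remaining terms of `e` nonnegative, as `tail-≤` requires.
      small ε 0<ε with ev-witness (limit-bounds converges ε 0<ε ∧ (N₀ , λ n N₀≤n → N₀≤n))
      ... | N , (s-ε≤p , p≤s+ε) , N₀≤N = begin
        measure μ limsup-Borel       ≤⟨ measure-mono limsup-Borel (Tail-Borel N)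
                                          (λ x∈ → dne (λ x∉ → x∈ (N , x∉))) ⟩
        measure μ (Tail-Borel N)     ≤⟨ measure-⋃-≤ (λ k → d (N ℕ.+ k)) (λ n → ≤-trans (partialSum-mono bound n)
                                          (tail-≤ {e} converges N
                                            (λ k → ≤-trans (measure-nonNeg μ (d (N ℕ.+ k))) (bound k)) n)) ⟩
        s - partialSum e N           ≤⟨ by-gap (gap s-ε≤p) (solve 3
                                          (λ s p ε → 𝟘 :+ ε := p :- (s :- ε) :+ (s :- p)) refl s (partialSum e N) ε) ⟩
        0# + ε                       ∎
        where
        open R
        bound : ∀ k → measure μ (d (N ℕ.+ k)) ≤ e (N ℕ.+ k)
        bound k = d≤e _ (ℕ.≤-trans N₀≤N (ℕ.m≤m+n N k))

-- Enumeration of pairs of natural numbers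

antidiagonal-walk : ℕ → ℕ × ℕ
antidiagonal-walk zero = 0 , 0
antidiagonal-walk (suc q) with antidiagonal-walk q
... | a , zero  = 0 , suc a
... | a , suc b = suc a , b

antidiagonal-walk-surjective : ∀ a b → ∃[ q ] antidiagonal-walk q ≡ (a , b)
antidiagonal-walk-surjective a b = reach (a ℕ.+ b) a b ≡.refl
  where
  next : ∀ {a b} → ∃[ q ] antidiagonal-walk q ≡ (a , suc b) → ∃[ q ] antidiagonal-walk q ≡ (suc a , b)
  next (q , eq) = suc q , step eq
    where
    step : ∀ {a b} → antidiagonal-walk q ≡ (a , suc b) → antidiagonal-walk (suc q) ≡ (suc a , b)
    step eq rewrite eq = ≡.refl

  wrap : ∀ {a} → ∃[ q ] antidiagonal-walk q ≡ (a , 0) → ∃[ q ] antidiagonal-walk q ≡ (0 , suc a)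
  wrap (q , eq) = suc q , step eq
    where
    step : ∀ {a} → antidiagonal-walk q ≡ (a , 0) → antidiagonal-walk (suc q) ≡ (0 , suc a)
    step eq rewrite eq = ≡.refl

  -- The walk is followed backwards: down to the start of the antidiagonal of sum s, then to the end
  -- of the previous one. The recursion is lexicographic in s and a.
  reach : ∀ s a b → a ℕ.+ b ≡ s → ∃[ q ] antidiagonal-walk q ≡ (a , b)
  reach s       zero    zero    _  = 0 , ≡.refl
  reach (suc s) zero    (suc b) eq = wrap (reach s b 0 (≡.trans (ℕ.+-identityʳ b) (ℕ.suc-injective eq)))
  reach s       (suc a) b       eq = next (reach s a (suc b) (≡.trans (ℕ.+-suc a b) eq))

-- Cells of a partition, their enumeration and their endpoints

module Partitions (lem : ExcludedMiddle 0ℓ) (ℝ : CompleteOrderedField) where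

  open Measure lem ℝ public

  Least : Pred ℕ 0ℓ → Pred ℕ 0ℓ
  Least P m = P m × (∀ k → k ℕ.< m → ¬ P k)

  least : ∀ {P : Pred ℕ 0ℓ} → ∃[ n ] P n → ∃[ m ] Least P m
  least {P} (n , Pn) = [ (λ found → found) , (λ none → contradiction Pn (none n ℕ.≤-refl)) ]′ (search (suc n))
    where
    search : ∀ n → ∃[ m ] Least P m ⊎ (∀ k → k ℕ.< n → ¬ P k)
    search zero = inj₂ λ k ()
    search (suc n) with search n | lem {P n}
    ... | inj₁ found | _      = inj₁ found
    ... | inj₂ none  | yes Pn = inj₁ (n , Pn , none)
    ... | inj₂ none  | no ¬Pn = inj₂ λ k k<1+n → [ none k , (λ { ≡.refl → ¬Pn }) ]′ (ℕ.m<1+n⇒m<n∨m≡n k<1+n)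

  rational : ℕ → Carrier
  rational q = let a , b = antidiagonal-walk q in fromℕ a * 1/ suc b

  -- With mesh δ < r - l, the least multiple of δ above l is still below r, since its predecessor is
  -- at most l. The multiple 0 is excluded by 0 ≤ l.
  rational-dense : ∀ {l r} → 0# ≤ l → l < r → ∃[ q ] l < rational q × rational q < r
  rational-dense {l} {r} 0≤l l<r = found (least exceeds)
    where
    b,δ<r-l = archimedean-⁻¹ (x<y⇒0<y-x l<r)

    b = proj₁ b,δ<r-l

    δ = 1/ suc b

    Exceeds : Pred ℕ 0ℓ
    Exceeds a = l < fromℕ a * δ

    exceeds : ∃[ a ] Exceeds a
    exceeds = let a , l/δ<a = archimedean (l / δ) in a , ≰⇒> λ aδ≤l →
      <⇒≱ l/δ<a (*≤⇒≤/ (1/suc-pos b) aδ≤l)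

    found : ∃[ a ] Least Exceeds a → ∃[ q ] l < rational q × rational q < r
    found (zero  , l<0δ , _) = contradiction (≤-respˡ (sym (zeroˡ δ)) 0≤l) (<⇒≱ l<0δ)
    found (suc a , l<aδ , minimal) = let q , eq = antidiagonal-walk-surjective (suc a) b in
      q , ≡.subst (λ (a , b) → l < fromℕ a * 1/ suc b × fromℕ a * 1/ suc b < r) (≡.sym eq)
        (l<aδ , ≰⇒> λ r≤aδ → <⇒≱ (proj₂ b,δ<r-l)
          (by-gap (gap r≤aδ ⊕ gap (≤-stable (minimal a ℕ.≤-refl)))
            (solve 4 (λ l r a δ → δ := (𝟙 :+ a) :* δ :- r :+ (l :- a :* δ) :+ (r :- l)) refl l r (fromℕ a) δ)))

  open TopologicalPartition

  module _ (P : TopologicalPartition) where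

    cell-unique : ∀ {i j x} → x ∈ interval P i → x ∈ interval P j → i ≡ j
    cell-unique {i} {j} {x} x∈i x∈j with lem {i ≡ j}
    ... | yes i≡j = i≡j
    ... | no  i≢j = ⊥-elim (disjoint P i≢j {x} (x∈i , x∈j))

    Hits : Index P → Pred ℕ 0ℓ
    Hits i q = ⟦ left P i ⟧ < rational q × rational q < ⟦ right P i ⟧

    hits : ∀ i → ∃[ q ] Least (Hits i) q
    hits i = least (rational-dense (proj₁ (proj₂ (left P i))) (nonempty P i))

    hit-unique : ∀ {i j q} → Hits i q → Hits j q → i ≡ j
    hit-unique {i} {j} {q} i∋q@(l<q , q<r) j∋q = cell-unique {x = rational q ,
      ≤-trans (proj₁ (proj₂ (left P i))) (<⇒≤ l<q) , ≤-trans (<⇒≤ q<r) (proj₂ (proj₂ (right P i)))} i∋q j∋q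

    Cells : Pred (Index P) 0ℓ → Pred 𝕀 0ℓ
    Cells S x = ∃[ i ] S i × x ∈ interval P i

    -- Any union of open intervals is open, so countability of the cells matters only when measures
    -- are added.
    Cells-Borel : ∀ S → Borel (Cells S)
    Cells-Borel S = open-set λ x (i , i∈S , x∈i) →
      ⟦ left P i ⟧ , ⟦ right P i ⟧ , x∈i , λ y∈i → i , i∈S , y∈i

    -- A set of cells is enumerated by the first rational in each cell.
    At : Pred (Index P) 0ℓ → ℕ → Pred (Index P) 0ℓ
    At S q i = S i × Least (Hits i) q

    Cells-At : ∀ S → ⋃ ℕ (Cells ∘ At S) ≐ Cells S
    Cells-At S = (λ (q , i , (i∈S , _) , x∈i) → i , i∈S , x∈i)
      , λ (i , i∈S , x∈i) → let q , first = hits i in q , i , (i∈S , first) , x∈i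

  Least-unique : ∀ {P : Pred ℕ 0ℓ} {m n} → Least P m → Least P n → m ≡ n
  Least-unique {m = m} {n} (Pm , minₘ) (Pn , minₙ) with ℕ.<-cmp m n
  ... | tri< m<n _ _ = contradiction Pm (minₙ m m<n)
  ... | tri≈ _ m≡n _ = m≡n
  ... | tri> _ _ n<m = contradiction Pn (minₘ n n<m)

  module _ (μ : BorelProbabilityMeasure) where

    cell-measure : (P : TopologicalPartition) → Index P → Carrier
    cell-measure P i = measure μ (interval-Borel P i)

    -- Cells containing a common rational coincide, so `At P S q` selects one cell at most; 0 ≤ c
    -- covers the case of none.
    measure-At-≤ : ∀ P S q {c} → 0# ≤ c → (∀ {i} → At P S q i → cell-measure P i ≤ c) →
                   measure μ (Cells-Borel P (At P S q)) ≤ c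
    measure-At-≤ P S q 0≤c bound with lem {∃[ i ] At P S q i}
    ... | yes (i , i∈) = ≤-trans
      (measure-mono μ _ (interval-Borel P i) λ {x} (j , j∈ , x∈j) →
        ≡.subst (λ k → x ∈ interval P k) (hit-unique P {q = q} (proj₁ (proj₂ j∈)) (proj₁ (proj₂ i∈))) x∈j)
      (bound i∈)
    ... | no none = ≤-trans
      (≤-respʳ (measure-∅ μ Borel-∅) (measure-mono μ _ Borel-∅ λ (i , i∈ , _) → none (i , i∈))) 0≤c

    measure-Cells-≤ : ∀ P S {c} →
      (∀ n → partialSum (λ q → measure μ (Cells-Borel P (At P S q))) n ≤ c) → measure μ (Cells-Borel P S) ≤ c
    measure-Cells-≤ P S bound = ≤-respˡ (measure-cong μ _ _ (Cells-At P S))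
      (measure-⋃-≤ μ (λ q → Cells-Borel P (At P S q)) bound)

    -- The null cells are countably many, so their union is null.
    cell-measure-pos : ∀ P → AlmostEverywhere μ λ x → ∀ {i} → x ∈ interval P i → 0# < cell-measure P i
    cell-measure-pos P = Cells P Null , Cells-Borel P Null
      , ≤0⇒null μ _ (measure-Cells-≤ P Null (partialSum-nonPos λ q → measure-At-≤ P Null q ≤-refl proj₁))
      , λ x x∉Null x∈i → ≰⇒> λ i≤0 → x∉Null (_ , i≤0 , x∈i)
      where
      Null : Pred (Index P) 0ℓ
      Null i = cell-measure P i ≤ 0#

    module _ (P Q : TopologicalPartition) (γ : Carrier) where

      -- The function `e` will be `left Q` or `right Q`. With one endpoint per cell, j determines
      -- the cell of P that contains `e j`.
      Cut : (Index Q → 𝕀) → Pred (Index P) 0ℓ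
      Cut e i = ∃[ j ] e j ∈ interval P i × cell-measure P i ≤ γ * cell-measure Q j

      -- Distinct cells of P contain the endpoints of distinct cells of Q, whose
      -- measures add up to at most 1.
      measure-Cut-≤ : 0# ≤ γ → ∀ e → measure μ (Cells-Borel P (Cut e)) ≤ γ
      measure-Cut-≤ 0≤γ e = measure-Cells-≤ P (Cut e) λ n → begin
        partialSum (λ q → measure μ (Cells-Borel P (At P (Cut e) q))) n    ≤⟨ partialSum-mono At-≤ n ⟩
        partialSum (λ q → γ * matched q) n                                 ≈⟨ partialSum-* γ matched n ⟩
        γ * partialSum matched n                                           ≤⟨ *-monoˡ-≤ 0≤γ (≤-trans
                                                                              (measure-⊥-≤ μ (Cells-Borel Q ∘ Matched) disjoint-matches n)
                                                                              (measure-≤1 μ (union (Cells-Borel Q ∘ Matched)))) ⟩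
        γ * 1#                                                             ≈⟨ *-identityʳ γ ⟩
        γ                                                                  ∎
        where
        open R
        Matched : ℕ → Pred (Index Q) 0ℓ
        -- All cells of Q that witness the cut are kept, which avoids choosing one for each cell of
        -- P.
        Matched q j = ∃[ i ] Least (Hits P i) q × e j ∈ interval P i × cell-measure P i ≤ γ * cell-measure Q j

        matched : ℕ → Carrier
        matched q = measure μ (Cells-Borel Q (Matched q))

        disjoint-matches : ∀ {q q′} → q ≢ q′ → Cells Q (Matched q) ⊥ Cells Q (Matched q′)
        -- A common point identifies the two cells of Q; their shared endpoint then identifies the
        -- two cells of P, and with them the first rationals.
        disjoint-matches q≢q′ {x} ((j , (i , first , ej∈i , _) , x∈j) , (j′ , (i′ , first′ , ej′∈i′ , _) , x∈j′))
          with cell-unique Q {j} {j′} {x} x∈j x∈j′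
        ... | ≡.refl with cell-unique P {i} {i′} {e j} ej∈i ej′∈i′
        ...   | ≡.refl = q≢q′ (Least-unique first first′)

        At-≤ : ∀ q → measure μ (Cells-Borel P (At P (Cut e) q)) ≤ γ * measure μ (Cells-Borel Q (Matched q))
        At-≤ q = measure-At-≤ P (Cut e) q (0≤γ ⊗ measure-nonNeg μ _) λ {i} ((j , ej∈i , small) , first) →
          ≤-trans small (*-monoˡ-≤ 0≤γ (measure-mono μ (interval-Borel Q j) (Cells-Borel Q (Matched q))
            λ x∈j → j , (i , first , ej∈i , small) , x∈j))

      -- A point of cell i outside cell j has an endpoint of j between itself and x, or is that
      -- endpoint. By convexity the endpoint lies in cell i, so x belongs to a cut cell.
      uncut-⊆ : ∀ {x i j} → x ∉ Cells P (Cut (left Q)) → x ∉ Cells P (Cut (right Q)) →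
                x ∈ interval P i → x ∈ interval Q j → cell-measure P i ≤ γ * cell-measure Q j →
                interval P i ⊆ interval Q j
      uncut-⊆ {x} {i} {j} x∉L x∉R x∈i@(l<x , x<r) (lⱼ<x , x<rⱼ) small (l<y , y<r) =
          (≰⇒> λ y≤lⱼ → x∉L (i , (j , (<-≤-trans l<y y≤lⱼ , <-≤-trans lⱼ<x (<⇒≤ x<r)) , small) , x∈i))
        , (≰⇒> λ rⱼ≤y → x∉R (i , (j , (<-≤-trans l<x (<⇒≤ x<rⱼ) , ≤-<-trans rⱼ≤y y<r) , small) , x∈i))

-- Suprema, tolerances and logarithmic estimates

module LochsIndex (lem : ExcludedMiddle 0ℓ) (ℝ : CompleteOrderedField) where

  open Partitions lem ℝ public
  open TopologicalPartition

  -- The alternative `L ≡ 0` covers the empty set, whose supremum among the extended naturals is 0.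
  maximum-or-0 : ∀ {S : Pred ℕ 0ℓ} N → (∀ ℓ → S ℓ → ℓ ℕ.≤ N) →
                 ∃[ L ] (∀ ℓ → S ℓ → ℓ ℕ.≤ L) × (L ≡ 0 ⊎ S L)
  maximum-or-0 zero    bound = 0 , bound , inj₁ ≡.refl
  maximum-or-0 {S} (suc N) bound with lem {S (suc N)}
  ... | yes S[1+N] = suc N , bound , inj₂ S[1+N]
  ... | no ¬S[1+N] = maximum-or-0 N λ ℓ Sℓ →
    ℕ.≤-pred (ℕ.≤∧≢⇒< (bound ℓ Sℓ) λ { ≡.refl → ¬S[1+N] Sℓ })

  supremum-of-maximum : ∀ {S : Pred ℕ 0ℓ} {L} → (∀ ℓ → S ℓ → ℓ ℕ.≤ L) → L ≡ 0 ⊎ S L →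
                        IsSupremum ℕ∞._≤⁺_ (λ s → ∃[ ℓ ] s ≡ [ ℓ ] × S ℓ) [ L ]
  supremum-of-maximum {S} {L} bound attained =
    (λ { _ (ℓ , ≡.refl , Sℓ) → ℕ∞.[ bound ℓ Sℓ ] }) , λ b ub → below b ub attained
    where
    below : ∀ b → IsUpperBound ℕ∞._≤⁺_ (λ s → ∃[ ℓ ] s ≡ [ ℓ ] × S ℓ) b → L ≡ 0 ⊎ S L → [ L ] ℕ∞.≤⁺ b
    below [ k ] ub (inj₁ ≡.refl) = ℕ∞.[ ℕ.z≤n ]
    below ⊤⁺    ub (inj₁ _)      = _ ℕ∞.≤⊤⁺
    below b     ub (inj₂ SL)     = ub [ L ] (L , ≡.refl , SL)

  ev-suc : ∀ {P : Pred ℕ 0ℓ} → Eventually (P ∘ suc) → Eventually P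
  ev-suc (N , p) = suc N , λ { (suc n) (ℕ.s≤s N≤n) → p n N≤n }

  -- Take m just before the least index at which f exceeds t. If that index is 0 there is nothing
  -- before it; m defaults to 0, and the first bound holds vacuously, hence its premise.
  bracket : ∀ {f : ℕ → Carrier} → (∀ {m n} → m ℕ.≤ n → f m ≤ f n) → f ⟶+∞ →
            ∀ t → ∃[ m ] (f 0 ≤ t → f m ≤ t) × t < f (suc m)
  bracket {f} mono f→∞ t = found (least exceeds)
    where
    exceeds : ∃[ n ] t < f n
    exceeds = let n , t+1≤f = ev-witness (f→∞ (t + 1#)) in
      n , <-≤-trans (≰⇒> λ t+1≤t → <⇒≱ 0<1 (nonNeg-neg (≤-respʳ
        (solve 1 (λ t → t :- (t :+ 𝟙) := :- 𝟙) refl t) (gap t+1≤t)))) t+1≤f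

    found : ∃[ n ] Least (λ n → t < f n) n → ∃[ m ] (f 0 ≤ t → f m ≤ t) × t < f (suc m)
    found (zero  , t<f0 , _)       = 0 , (λ f0≤t → f0≤t) , <-≤-trans t<f0 (mono ℕ.z≤n)
    found (suc m , t<f , minimal) = m , (λ _ → ≤-stable (minimal m ℕ.≤-refl)) , t<f

  3# 4# : Carrier
  3# = 1# + 1# + 1#
  4# = 1# + 1# + 1# + 1#

  𝟛 𝟜 : ∀ {n} → Polynomial n
  𝟛 = con (ℤ.+ 3)
  𝟜 = con (ℤ.+ 4)

  0<4 : 0# < 4#
  0<4 = +-pos-nonNeg (+-pos-nonNeg 0<2 0≤1) 0≤1

  ev-nonNeg : ∀ {f} → f ⟶+∞ → Eventually (λ n → 0# ≤ f n)
  ev-nonNeg f→∞ = f→∞ 0#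

  ev-pos : ∀ {f} → f ⟶+∞ → Eventually (λ n → 0# < f n)
  ev-pos f→∞ = ev-map (λ n → <-≤-trans 0<1) (f→∞ 1#)

  scaled-diverges : ∀ {f c} → 0# < c → f ⟶+∞ → (λ n → c * f n) ⟶+∞
  scaled-diverges {f} {c} 0<c f→∞ M = ev-map
    (λ n M/c≤f → ≤-respʳ (*-comm _ _) (/≤⇒≤* 0<c M/c≤f)) (f→∞ (M / c))

  ratio-bounds : ∀ {a f : ℕ → Carrier} → f ⟶+∞ → (λ n → a n / f n) ⟶ 1# → ∀ {η} → 0# < η →
                 Eventually (λ n → (1# - η) * f n ≤ a n × a n ≤ (1# + η) * f n)
  ratio-bounds {a} {f} f→∞ a/f⟶1 {η} 0<η = ev-map
    (λ n (0<f , lo , hi) → ≤/⇒*≤ 0<f lo , /≤⇒≤* 0<f hi)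
    (ev-pos f→∞ ∧ limit-bounds {a = λ n → a n / f n} a/f⟶1 η 0<η)

  bounds-ratio : ∀ {a f δ ε} → 0# < f → δ < ε → (1# - δ) * f ≤ a → a ≤ (1# + δ) * f → ∣ a / f - 1# ∣ < ε
  bounds-ratio 0<f δ<ε lo hi = ≤-<-trans (bounds⇒∣x-l∣≤ε (*≤⇒≤/ 0<f lo) (≤*⇒/≤ 0<f hi)) δ<ε

  -- The bound 4η ≤ 1 keeps 1 - η positive, 1 - 3η at least η, and (1 + η)/(1 - η) at most 1 + 4η.
  record Tolerance (η : Carrier) : Set where
    field
      pos  : 0# < η
      4η≤1 : 4# * η ≤ 1#

    0≤η : 0# ≤ η
    0≤η = <⇒≤ pos

    0<1-η : 0# < 1# - η
    0<1-η = <-≤-trans pos (by-gap (gap 4η≤1 ⊕ 0≤η ⊕ 0≤η)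
      (solve 1 (λ η → 𝟙 :- η := 𝟙 :- 𝟜 :* η :+ η :+ η :+ η) refl η))

    0<1+η : 0# < 1# + η
    0<1+η = +-pos-nonNeg 0<1 0≤η

  tolerance : ℕ → Carrier
  tolerance k = 1/ suc k / 4#

  4*tolerance : ∀ k → 4# * tolerance k ≈ 1/ suc k
  4*tolerance k = trans (*-comm _ _) (/-* 0<4)

  isTolerance : ∀ k → Tolerance (tolerance k)
  isTolerance k = record
    { pos  = *-pos (1/suc-pos k) (⁻¹-pos 0<4)
    ; 4η≤1 = ≤-respˡ (sym (4*tolerance k)) (≤-respʳ (k*k⁻¹≈1 k)
        (by-gap (0≤fromℕ k ⊗ <⇒≤ (1/suc-pos k))
          (solve 2 (λ k q → (𝟙 :+ k) :* q := k :* q :+ q) refl (fromℕ k) (1/ suc k))))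
    }

  record LogEstimate (η m f : Carrier) : Set where
    field
      exp-log-m : exp (log m) ≈ m
      log≤0     : log m ≤ 0#
      0≤f       : 0# ≤ f
      lower     : (1# - η) * f ≤ - log m
      upper     : - log m ≤ (1# + η) * f

  log-estimates : ∀ {m f : ℕ → Carrier} → f ⟶+∞ → (λ n → (- log (m n)) / f n) ⟶ 1# →
                  ∀ {η} → Tolerance η → Eventually (λ n → LogEstimate η (m n) (f n))
  log-estimates {m} {f} f→∞ ratio τ = ev-map
    (λ n (0<f , lo , hi) →
      let 0<-log = <-≤-trans (*-pos 0<1-η 0<f) lo
      in record
        -- The positive lower bound for - log m excludes the default value 0 of `log`.
        { exp-log-m = exp-log λ log≈0 → <-irrefl (<-≤-trans 0<-log
            (≤-reflexive (trans (-‿cong log≈0) -0≈0)))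
        ; log≤0     = nonNeg-neg (<⇒≤ 0<-log)
        ; 0≤f       = <⇒≤ 0<f
        ; lower     = lo
        ; upper     = hi
        })
    (ev-pos f→∞ ∧ ratio-bounds {λ n → - log (m n)} {f} f→∞ ratio pos)
    where open Tolerance τ

  module _ {η a b f₁ f₂} (τ : Tolerance η) (A : LogEstimate η a f₁) (B : LogEstimate η b f₂) where

    private
      module La = LogEstimate A
      module Lb = LogEstimate B
    open Tolerance τ

    -- The chain is (1 - η) f₂ ≤ - log b ≤ - log a ≤ (1 + η) f₁, and (1 - η)(1 + 4η) exceeds 1 + η
    -- by η(1 - 4η) + η.
    weight-≤ : a ≤ b → f₂ ≤ (1# + 4# * η) * f₁
    weight-≤ a≤b = *-cancelˡ-≤ 0<1-η (by-gap
      (gap Lb.lower ⊕ gap log-≤ ⊕ gap La.upper ⊕ (0≤η ⊗ gap 4η≤1 ⊕ 0≤η) ⊗ La.0≤f)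
      (solve 5 (λ η f₁ f₂ la lb →
          (𝟙 :- η) :* ((𝟙 :+ 𝟜 :* η) :* f₁)
            := (:- lb) :- (𝟙 :- η) :* f₂ :+ (lb :- la) :+ ((𝟙 :+ η) :* f₁ :- (:- la))
               :+ (η :* (𝟙 :- 𝟜 :* η) :+ η) :* f₁ :+ (𝟙 :- η) :* f₂)
        refl η f₁ f₂ (log a) (log b)))
      where
      log-≤ : log a ≤ log b
      log-≤ = exp-cancel-≤ La.log≤0 (≤-respˡ (sym La.exp-log-m) (≤-respʳ (sym Lb.exp-log-m) a≤b))

    -- Origin of 3η: the two logarithmic errors use up about 2η, and one η must remain. Exactly, (1
    -- - η) - (1 + η)(1 - 3η) = η + 3η².
    measure-≤ : f₂ ≤ (1# - 3# * η) * f₁ → a ≤ exp (- (η * f₁)) * b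
    measure-≤ f₂≤ = begin
      a                                    ≈⟨ La.exp-log-m ⟨
      exp (log a)                          ≤⟨ exp-mono-≤ log-≤ (≤-respʳ (+-identityˡ 0#) (+-mono-≤ -ηf≤0 Lb.log≤0)) ⟩
      exp (- (η * f₁) + log b)             ≤⟨ exp-+-≤ -ηf≤0 Lb.log≤0 ⟩
      exp (- (η * f₁)) * exp (log b)       ≈⟨ *-congˡ Lb.exp-log-m ⟩
      exp (- (η * f₁)) * b                 ∎
      where
      open R
      -ηf≤0 : - (η * f₁) ≤ 0#
      -ηf≤0 = neg-nonPos (0≤η ⊗ La.0≤f)

      log-≤ : log a ≤ - (η * f₁) + log b
      log-≤ = by-gap
        (gap La.lower ⊕ gap Lb.upper ⊕ <⇒≤ 0<1+η ⊗ gap f₂≤ ⊕ ((0≤1 ⊕ 0≤1) ⊕ 0≤1) ⊗ (0≤square η ⊗ La.0≤f))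
        (solve 5 (λ η f₁ f₂ la lb →
            :- (η :* f₁) :+ lb
              := (:- la) :- (𝟙 :- η) :* f₁ :+ ((𝟙 :+ η) :* f₂ :- (:- lb))
                 :+ (𝟙 :+ η) :* ((𝟙 :- 𝟛 :* η) :* f₁ :- f₂) :+ 𝟛 :* (η :* η :* f₁) :+ la)
          refl η f₁ f₂ (log a) (log b))

  -- Target indices and typical points

  module _ (μ : BorelProbabilityMeasure) (P¹ P² : PartitionSequence) (f₁ f₂ : ℕ → Carrier)
           (f₁→∞ : f₁ ⟶+∞) (f₂→∞ : f₂ ⟶+∞) (f₂-mono : ∀ {m n} → m ℕ.≤ n → f₂ m ≤ f₂ n)
           where

    module _ {η} (τ : Tolerance η) where

      open Tolerance τ

      threshold : ℕ → Carrier
      threshold n = (1# - 3# * η) * f₁ n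

      threshold→∞ : threshold ⟶+∞
      threshold→∞ M = ev-map
        (λ n (M≤ηf , 0≤f) → ≤-trans M≤ηf (by-gap (gap 4η≤1 ⊗ 0≤f)
          (solve 2 (λ η f → (𝟙 :- 𝟛 :* η) :* f := (𝟙 :- 𝟜 :* η) :* f :+ η :* f) refl η (f₁ n))))
        (scaled-diverges pos f₁→∞ M ∧ ev-nonNeg f₁→∞)

      target-bracket : ∀ n → ∃[ m ] (f₂ 0 ≤ threshold n → f₂ m ≤ threshold n) × threshold n < f₂ (suc m)
      target-bracket n = bracket f₂-mono f₂→∞ (threshold n)

      target : ℕ → ℕ
      target n = proj₁ (target-bracket n)

      target-≤ : Eventually (λ n → f₂ (target n) ≤ threshold n)
      target-≤ = ev-map (λ n → proj₁ (proj₂ (target-bracket n))) (threshold→∞ (f₂ 0))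

      -- If `target n < N`, then `threshold n < f₂ N` by monotonicity, which fails for large n. This
      -- carries eventual facts about P² and f₂ over to the target indices.
      target→∞ : ∀ N → Eventually (λ n → N ℕ.≤ target n)
      target→∞ N = ev-map
        (λ n f₂N≤t → ℕ.≮⇒≥ λ m<N → <⇒≱ (proj₂ (proj₂ (target-bracket n))) (≤-trans (f₂-mono m<N) f₂N≤t))
        (threshold→∞ (f₂ N))

      -- Stepping back from m + 1, where f₂ exceeds the threshold, costs a factor 1 + η by (iii).
      -- The loss fits into one more η because (1 + η)(1 - 4η) = 1 - 3η - 4η².
      target-≥ : IsLittleO (λ n → f₂ (suc n) - f₂ n) f₂ →
                 Eventually (λ n → (1# - 4# * η) * f₁ n ≤ f₂ (target n))
      target-≥ gaps = ev-map
        (λ n ((0≤f₂ , small) , 0≤f₁) → *-cancelˡ-≤ 0<1+η (by-gap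
          (gap (<⇒≤ (proj₂ (proj₂ (target-bracket n))))
            ⊕ gap (≤-trans (x≤∣x∣ _) (≤-trans small (*-monoˡ-≤ 0≤η (nonNeg⇒∣x∣≤x 0≤f₂))))
            ⊕ <⇒≤ 0<4 ⊗ (0≤square η ⊗ 0≤f₁))
          (solve 4 (λ η f₁ g g′ →
              (𝟙 :+ η) :* g := g′ :- (𝟙 :- 𝟛 :* η) :* f₁ :+ (η :* g :- (g′ :- g))
                :+ 𝟜 :* (η :* η :* f₁) :+ (𝟙 :+ η) :* ((𝟙 :- 𝟜 :* η) :* f₁))
            refl η (f₁ n) (f₂ (target n)) (f₂ (suc (target n))))))
        (ev-∘ target→∞ (ev-nonNeg f₂→∞ ∧ gaps η pos) ∧ ev-nonNeg f₁→∞)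

      ratio-bound : ℕ → Carrier
      ratio-bound n = exp (- (η * f₁ n))

      ratio-bound-pos : Eventually (λ n → 0# < ratio-bound n)
      ratio-bound-pos = ev-map
        (λ n 0≤f₁ → exp-pos (neg-nonPos (0≤η ⊗ 0≤f₁)))
        (ev-nonNeg f₁→∞)

      CutAt : ((Q : TopologicalPartition) → Index Q → 𝕀) → ℕ → Pred 𝕀 0ℓ
      CutAt e n = Cells (P¹ n) (Cut μ (P¹ n) (P² (target n)) (ratio-bound n) (e (P² (target n))))

      -- The series in (i) begins at index 1, so Borel-Cantelli is applied to the shifted sets and
      -- `ev-suc` undoes the shift.
      ae-uncut : Summable (λ n → exp (- (η * f₁ (suc n)))) → ∀ e →
                 AlmostEverywhere μ λ x → Eventually (λ n → x ∉ CutAt e n)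
      ae-uncut summable e = ae-map μ ev-suc (borel-cantelli μ {CutAt e ∘ suc}
        (λ n → Cells-Borel (P¹ (suc n)) _) summable
        (ev-map (λ n 0<γ → measure-Cut-≤ μ (P¹ (suc n)) (P² (target (suc n))) (ratio-bound (suc n))
            (<⇒≤ 0<γ) (e (P² (target (suc n)))))
          (let N , p = ratio-bound-pos in N , λ n N≤n → p (suc n) (ℕ.m≤n⇒m≤1+n N≤n))))

    Balanced : PartitionSequence → (ℕ → Carrier) → Pred 𝕀 0ℓ
    Balanced P f x = Σ[ x∉E ∈ x ∉ E P ]
      Eventually (λ n → 0# < measure μ (I-Borel P x x∉E n)) ×
      (λ n → (- log (measure μ (I-Borel P x x∉E n))) / f n) ⟶ 1#

    Typical : Pred 𝕀 0ℓ
    Typical x = Balanced P¹ f₁ x × Balanced P² f₂ x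
      × (∀ n {i} → x ∈ interval (P¹ n) i → 0# < cell-measure μ (P¹ n) i)
      × (∀ k → Eventually (λ n → x ∉ CutAt (isTolerance k) left n)
             × Eventually (λ n → x ∉ CutAt (isTolerance k) right n))

    -- The Lochs index at a typical point

    module _ (gaps : IsLittleO (λ n → f₂ (suc n) - f₂ n) f₂) {x} (typical : Typical x) where

      private
        x∉E¹ = proj₁ (proj₁ typical)
        x∉E² = proj₁ (proj₁ (proj₂ typical))

        a b : ℕ → Carrier
        a n = measure μ (I-Borel P¹ x x∉E¹ n)
        b n = measure μ (I-Borel P² x x∉E² n)

        S : ℕ → Pred ℕ 0ℓ
        S n ℓ = I P¹ x x∉E¹ n ⊆ I P² x x∉E² ℓ

        S⇒≤ : ∀ {n ℓ} → S n ℓ → a n ≤ b ℓ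
        S⇒≤ {n} {ℓ} = measure-mono μ (I-Borel P¹ x x∉E¹ n) (I-Borel P² x x∉E² ℓ)

        a-pos : ∀ n → 0# < a n
        a-pos n = proj₁ (proj₂ (proj₂ typical)) n (proj₂ (cell P¹ x x∉E¹ n))

        a-estimates : ∀ {η} → Tolerance η → Eventually (λ n → LogEstimate η (a n) (f₁ n))
        a-estimates = log-estimates f₁→∞ (proj₂ (proj₂ (proj₁ typical)))

        b-estimates : ∀ {η} → Tolerance η → Eventually (λ n → LogEstimate η (b n) (f₂ n))
        b-estimates = log-estimates f₂→∞ (proj₂ (proj₂ (proj₁ (proj₂ typical))))

      b-small : ∀ {c} → 0# < c → Eventually (λ ℓ → b ℓ < c)
      b-small {c} 0<c = ev-map
        (λ ℓ (B , M≤) → ≤-<-trans (≤-reflexive (sym (LogEstimate.exp-log-m B)))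
          (exp<c (by-gap (gap M≤ ⊕ gap (LogEstimate.lower B))
            (solve 3 (λ M g l → :- M := g :- M :+ (:- l :- g) :+ l) refl M ((1# - tolerance 0) * f₂ ℓ) (log (b ℓ))))))
        -- Any fixed tolerance serves for decay to 0; here it is 1/4.
        (b-estimates (isTolerance 0) ∧ scaled-diverges (Tolerance.0<1-η (isTolerance 0)) f₂→∞ M)
        where
        M = proj₁ (exp-small 0<c)
        exp<c = proj₂ (exp-small 0<c)

      -- The measure `a n` is a fixed positive number while `b ℓ` tends to 0, so the admissible ℓ
      -- are bounded.
      lochs : ∀ n → ∃[ L ] (∀ ℓ → S n ℓ → ℓ ℕ.≤ L) × (L ≡ 0 ⊎ S n L)
      lochs n = let N , small = b-small (a-pos n) in maximum-or-0 {S n} N λ ℓ a⊆b →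
        ℕ.≮⇒≥ λ N<ℓ → <⇒≱ (small ℓ (ℕ.<⇒≤ N<ℓ)) (S⇒≤ {n} {ℓ} λ {y} → a⊆b {y})

      L : ℕ → ℕ
      L n = proj₁ (lochs n)

      -- The estimate for `b` holds from some N on, and `L n` may lie below N. In that case f₂ (L n)
      -- ≤ f₂ N ≤ f₁ n for large n.
      L-upper : ∀ {η} → Tolerance η → Eventually (λ n → f₂ (L n) ≤ (1# + 4# * η) * f₁ n)
      L-upper {η} τ = ev-map (λ n (A , f₂N≤f₁) → bound n A f₂N≤f₁ (proj₂ (proj₂ (lochs n))) (ℕ.≤-total (L n) N))
        (a-estimates τ ∧ f₁→∞ (f₂ N))
        where
        open Tolerance τ
        N = proj₁ (b-estimates τ)

        small : ∀ n → LogEstimate η (a n) (f₁ n) → f₂ N ≤ f₁ n → L n ℕ.≤ N → f₂ (L n) ≤ (1# + 4# * η) * f₁ n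
        small n A f₂N≤f₁ L≤N = ≤-trans (≤-trans (f₂-mono L≤N) f₂N≤f₁)
          (by-gap (<⇒≤ 0<4 ⊗ (0≤η ⊗ LogEstimate.0≤f A))
            (solve 2 (λ η f → (𝟙 :+ 𝟜 :* η) :* f := 𝟜 :* (η :* f) :+ f) refl η (f₁ n)))

        bound : ∀ n → LogEstimate η (a n) (f₁ n) → f₂ N ≤ f₁ n → L n ≡ 0 ⊎ S n (L n) → L n ℕ.≤ N ⊎ N ℕ.≤ L n →
                f₂ (L n) ≤ (1# + 4# * η) * f₁ n
        bound n A f₂N≤f₁ _           (inj₁ L≤N) = small n A f₂N≤f₁ L≤N
        -- The value 0 may stem from the empty set, with no inclusion of intervals to exploit; it
        -- counts as a small index.
        bound n A f₂N≤f₁ (inj₁ L≡0)  (inj₂ _)   = small n A f₂N≤f₁ (≡.subst (ℕ._≤ N) (≡.sym L≡0) ℕ.z≤n)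
        bound n A f₂N≤f₁ (inj₂ SL)   (inj₂ N≤L) = weight-≤ τ A
          (proj₂ (b-estimates τ) (L n) N≤L) (S⇒≤ {n} {L n} λ {y} → SL {y})

      L-lower : ∀ k → let η = tolerance k in Eventually (λ n → (1# - 4# * η) * f₁ n ≤ f₂ (L n))
      L-lower k = ev-map
        (λ n (A , B , f₂≤t , t≤f₂ , x∉left , x∉right) → ≤-trans t≤f₂ (f₂-mono (proj₁ (proj₂ (lochs n)) (target τ n)
          (λ {y} → uncut-⊆ μ (P¹ n) (P² (target τ n)) (ratio-bound τ n) {x} x∉left x∉right
            (proj₂ (cell P¹ x x∉E¹ n)) (proj₂ (cell P² x x∉E² (target τ n))) (measure-≤ τ A B f₂≤t) {y}))))
        (a-estimates τ ∧ ev-∘ (target→∞ τ) (b-estimates τ) ∧ target-≤ τ ∧ target-≥ τ gaps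
          ∧ proj₁ uncut ∧ proj₂ uncut)
        where
        τ = isTolerance k
        uncut = proj₂ (proj₂ (proj₂ typical)) k

      L-ratio : (λ n → f₂ (L n) / f₁ n) ⟶ 1#
      L-ratio ε 0<ε = let k , 1/k<ε = archimedean-⁻¹ 0<ε in ev-map
        -- Both bounds deviate from 1 by 4η, which for this tolerance is 1/(k+1) and thus less than
        -- ε.
        (λ n (0<f₁ , lo , hi) → bounds-ratio 0<f₁ (≤-<-trans (≤-reflexive (4*tolerance k)) 1/k<ε) lo hi)
        (ev-pos f₁→∞ ∧ L-lower k ∧ L-upper (isTolerance k))

      typical⇒conclusion : Σ[ x∉E¹ ∈ x ∉ E P¹ ] Σ[ x∉E² ∈ x ∉ E P² ] Σ[ L ∈ (ℕ → ℕ) ]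
        (∀ n → IsLochsIndex P¹ P² x x∉E¹ x∉E² n [ L n ]) × (λ n → f₂ (L n) / f₁ n) ⟶ 1#
      typical⇒conclusion = x∉E¹ , x∉E² , L
        , (λ n → supremum-of-maximum {S n} (proj₁ (proj₂ (lochs n))) (proj₂ (proj₂ (lochs n)))) , L-ratio

theorem6p8 : (lem : ExcludedMiddle 0ℓ) (ℝ : CompleteOrderedField) →
  let open CompleteOrderedField ℝ
      open Analysis lem ℝ in
  (μ : BorelProbabilityMeasure) (P¹ P² : PartitionSequence) (f₁ f₂ : ℕ → Carrier) →
  IsWeightFunction μ P¹ f₁ →
  IsWeightFunction μ P² f₂ →
  (∀ δ → 0# < δ → Summable (λ n → exp (- (δ * f₁ (suc n))))) →
  (∀ {m n} → m ≤ℕ n → f₂ m ≤ f₂ n) →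
  IsLittleO (λ n → f₂ (suc n) - f₂ n) f₂ →
  AlmostEverywhere μ λ x →
    Σ[ x∉E¹ ∈ x ∉ E P¹ ] Σ[ x∉E² ∈ x ∉ E P² ] Σ[ L ∈ (ℕ → ℕ) ]
      (∀ n → IsLochsIndex P¹ P² x x∉E¹ x∉E² n [ L n ]) ×
      (λ n → f₂ (L n) / f₁ n) ⟶ 1#
theorem6p8 lem ℝ μ P¹ P² f₁ f₂ w₁ w₂ summable f₂-mono gaps =
  ae-map μ (λ {x} → typical⇒conclusion μ P¹ P² f₁ f₂ W₁.diverges W₂.diverges f₂-mono gaps {x})
    (ae-× μ W₁.balanced (ae-× μ W₂.balanced (ae-× μ
      (ae-∀ μ (λ n → cell-measure-pos μ (P¹ n)))
      (ae-∀ μ λ k → ae-× μ (uncut k TopologicalPartition.left) (uncut k TopologicalPartition.right)))))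
  where
  open LochsIndex lem ℝ
  module W₁ = IsWeightFunction w₁
  module W₂ = IsWeightFunction w₂
  uncut = λ k → ae-uncut μ P¹ P² f₁ f₂ W₁.diverges W₂.diverges f₂-mono (isTolerance k)
    (summable (tolerance k) (Tolerance.pos (isTolerance k)))
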